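{- Let $k>0$ be a constant and let $p:\mathbb{N}\to\mathbb{N}$ be a function with $p(n)=\omega(\sqrt n)$ and $p(n)\le n^2$ for all $n$. Then for every constant $C>0$ there are infinitely many $n$ for which there exist an $n$-node graph $G=(V,E)$ and a set $P\subseteq V\times V$ of exactly $|P|=p(n)$ demand pairs such that no subgraph $H\subseteq G$ on the same vertex set with at most $Cn$ edges is a $+k$ pairwise additive spanner of $G$ with respect to $P$. (That is, such $(G,P)$ do not admit a $+k$ pairwise spanner on $O(n)$ edges.)
   Context: Graphs are finite, simple, undirected and unweighted; $\mathrm{dist}_G(s,t)$ is the shortest-path distance (number of edges) in $G$, with value $+\infty$ if $s,t$ are disconnected. For a graph $G=(V,E)$ and a set of demand pairs $P\subseteq V\times V$, a subgraph $H\subseteq G$ is a $+k$ (pairwise) additive spanner of $G$ with respect to $P$ if for all $(s,t)\in P$ we have $\mathrm{dist}_H(s,t)\le \mathrm{dist}_G(s,t)+k$. -}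

module Defs where

open import Data.Bool.Base using (Bool; false; T)
open import Data.Bool.Properties using (T?)
open import Data.Fin.Base as Fin using (Fin; zero; suc; toℕ; fromℕ<)
import Data.Fin.Properties as Fin
open import Data.Integer.Base using (+_)
open import Data.List.Base using (List; length; filter; allFin; cartesianProduct)
open import Data.List.Membership.Propositional using (_∈_)
open import Data.Nat.Base using (ℕ; zero; suc; _+_; _∸_; _≤_; _<_; z<s; s≤s; s≤s⁻¹)
open import Data.Nat.Induction using (<-rec)
import Data.Nat.Properties as ℕ
open import Data.Product using (∃-syntax; _×_; _,_; proj₁; proj₂)
open import Data.Rational.Base as ℚ using (ℚ; 0ℚ)
open import Data.Rational.Literals using (fromℤ)
open import Function.Base using (_∘_)
open import Relation.Binary.Construct.Add.Supremum.NonStrict _≤_ using (_≤⁺_)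
open import Relation.Binary.PropositionalEquality using (_≡_; refl; sym; subst)
open import Relation.Nullary using (¬_; Dec; yes; no; contradiction; map′; _×-dec_)
open import Relation.Nullary.Construct.Add.Supremum using (_⁺; [_]; ⊤⁺)

private variable
  n : ℕ

record Graph (n : ℕ) : Set where
  field
    adj   : Fin n → Fin n → Bool
    symm  : ∀ u v → adj u v ≡ adj v u
    irrfl : ∀ v → adj v v ≡ false

open Graph public

Adj : Graph n → Fin n → Fin n → Set
Adj G u v = T (adj G u v)

-- Each undirected edge {u , v} is listed once, as the pair with u < v.
edges : Graph n → List (Fin n × Fin n)
edges {n} G =
  filter (λ (u , v) → (u Fin.<? v) ×-dec T? (adj G u v))
         (cartesianProduct (allFin n) (allFin n))

∣E_∣ : Graph n → ℕ
∣E G ∣ = length (edges G)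

infix 4 _⊆ᴳ_
_⊆ᴳ_ : Graph n → Graph n → Set
H ⊆ᴳ G = ∀ u v → Adj H u v → Adj G u v

infixr 5 _∷_
data Walk (G : Graph n) : Fin n → Fin n → ℕ → Set where
  []  : ∀ {s} → Walk G s s 0
  _∷_ : ∀ {s u t l} → Adj G s u → Walk G u t l → Walk G s t (suc l)

ℕ∞ : Set
ℕ∞ = ℕ ⁺

infixl 6 _+∞_
_+∞_ : ℕ∞ → ℕ → ℕ∞
[ d ] +∞ k = [ d + k ]
⊤⁺    +∞ k = ⊤⁺

IsDist : Graph n → Fin n → Fin n → ℕ∞ → Set
IsDist G s t [ d ] = Walk G s t d × (∀ l → Walk G s t l → d ≤ l)
IsDist G s t ⊤⁺    = ∀ l → ¬ Walk G s t l

module _ (G : Graph n) where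

  walk? : ∀ s t l → Dec (Walk G s t l)
  walk? s t zero = map′ (λ { refl → [] }) (λ { [] → refl }) (s Fin.≟ t)
  walk? s t (suc l) =
    map′ (λ { (_ , a , w) → a ∷ w }) (λ { (a ∷ w) → _ , a , w })
         (Fin.any? (λ u → T? (adj G s u) ×-dec walk? u t l))

  _++ʷ_ : ∀ {s u t k l} → Walk G s u k → Walk G u t l → Walk G s t (k + l)
  []      ++ʷ w′ = w′
  (a ∷ w) ++ʷ w′ = a ∷ (w ++ʷ w′)

  vertex : ∀ {s t l} → Walk G s t l → Fin (suc l) → Fin n
  vertex {s} w       zero    = s
  vertex     (_ ∷ w) (suc i) = vertex w i

  takeʷ : ∀ {s t l} (w : Walk G s t l) i → Walk G s (vertex w i) (toℕ i)
  takeʷ w       zero    = []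
  takeʷ (a ∷ w) (suc i) = a ∷ takeʷ w i

  dropʷ : ∀ {s t l} (w : Walk G s t l) i → Walk G (vertex w i) t (l ∸ toℕ i)
  dropʷ w       zero    = w
  dropʷ (_ ∷ w) (suc i) = dropʷ w i

  shorten : ∀ {s t l} → n ≤ l → Walk G s t l → ∃[ l′ ] l′ < l × Walk G s t l′
  shorten {s} {t} {l} n≤l w
    with i , j , i<j , eq ← Fin.pigeonhole (s≤s n≤l) (vertex w)
    = toℕ i + (l ∸ toℕ j)
    , subst (toℕ i + (l ∸ toℕ j) <_) (ℕ.m+[n∸m]≡n (s≤s⁻¹ (Fin.toℕ<n j)))
            (ℕ.+-monoˡ-< (l ∸ toℕ j) i<j)
    , takeʷ w i ++ʷ subst (λ v → Walk G v t _) (sym eq) (dropʷ w j)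

  short-walk : ∀ s t l → Walk G s t l → ∃[ i ] Walk G s t (toℕ {n} i)
  short-walk s t = <-rec _ λ l rec w → step l (λ {m} → rec {m}) w (l ℕ.<? n)
    where
    step : ∀ l → (∀ {m} → m < l → Walk G s t m → ∃[ i ] Walk G s t (toℕ {n} i)) →
           Walk G s t l → Dec (l < n) → ∃[ i ] Walk G s t (toℕ {n} i)
    step l rec w (yes l<n) = fromℕ< l<n , subst (Walk G s t) (sym (Fin.toℕ-fromℕ< l<n)) w
    step l rec w (no l≮n) with _ , l′<l , w′ ← shorten (ℕ.≮⇒≥ l≮n) w = rec l′<l w′

  shortest : ∀ s t l → Walk G s t l → ∃[ d ] IsDist G s t [ d ]
  shortest s t = <-rec _ λ l rec w → step l (λ {m} → rec {m}) w (Fin.any? (walk? s t ∘ toℕ))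
    where
    step : ∀ l → (∀ {m} → m < l → Walk G s t m → ∃[ d ] IsDist G s t [ d ]) →
           Walk G s t l → Dec (∃[ i ] Walk G s t (toℕ {l} i)) → ∃[ d ] IsDist G s t [ d ]
    step l rec w (yes (i , w′)) = rec (Fin.toℕ<n i) w′
    step l rec w (no ¬shorter)  = l , w , λ m w′ → ℕ.≮⇒≥ λ m<l →
      ¬shorter (fromℕ< m<l , subst (Walk G s t) (sym (Fin.toℕ-fromℕ< m<l)) w′)

  dist-exists : ∀ s t → ∃[ d ] IsDist G s t d
  dist-exists s t with Fin.any? (walk? s t ∘ toℕ {n})
  ... | yes (i , w) with d , isDist ← shortest s t (toℕ i) w = [ d ] , isDist
  ... | no ¬walk    = ⊤⁺ , λ l w → ¬walk (short-walk s t l w)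

dist : Graph n → Fin n → Fin n → ℕ∞
dist G s t = proj₁ (dist-exists G s t)

dist-isDist : ∀ (G : Graph n) s t → IsDist G s t (dist G s t)
dist-isDist G s t = proj₂ (dist-exists G s t)

IsPairwiseSpanner : ℕ → (G : Graph n) → List (Fin n × Fin n) → Graph n → Set
IsPairwiseSpanner k G P H =
  H ⊆ᴳ G × (∀ s t → (s , t) ∈ P → dist H s t ≤⁺ dist G s t +∞ k)

ℕ→ℚ : ℕ → ℚ
ℕ→ℚ n = fromℤ (+ n)

-- f(n) = ω(√n): for every c > 0, eventually c √n < f(n). Both sides are
-- nonnegative, so the inequality is stated squared. Rational c suffice, as every
-- positive real is at most some rational.
_isω√n : (ℕ → ℕ) → Set
f isω√n = ∀ (c : ℚ) → 0ℚ ℚ.< c →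
  ∃[ N ] ∀ n → N ≤ n → (c ℚ.* c) ℚ.* ℕ→ℚ n ℚ.< ℕ→ℚ (f n) ℚ.* ℕ→ℚ (f n)

InfinitelyMany : (ℕ → Set) → Set
InfinitelyMany Q = ∀ N → ∃[ n ] N ≤ n × Q n

{-# OPTIONS --safe #-}
module Submission where

open import Defs
open import Data.Bool.Base using (Bool; T; _∨_; if_then_else_)
open import Data.Bool.Properties using (T?; T-∨; ∨-comm)
open import Data.Empty using (⊥-elim)
open import Data.Fin.Base as Fin
  using (Fin; zero; suc; toℕ; combine; quotient; remainder; splitAt; join; finToFun; funToFin)
import Data.Fin.Properties as Fin
open import Data.Integer.Base as ℤ using (ℤ; +_; 0ℤ)
import Data.Integer.Properties as ℤ
import Data.Integer.Tactic.RingSolver as ℤSolver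
open import Data.List.Base
  using (List; []; _∷_; _++_; length; lookup; map; filter; allFin; cartesianProduct; downFrom)
open import Data.List.Membership.Propositional using (_∈_; find)
open import Data.List.Membership.Propositional.Properties
  using (∈-lookup; ∈-map⁺; ∈-filter⁺; ∈-filter⁻; ∈-cartesianProduct⁺; ∈-cartesianProduct⁻; ∈-allFin; ∈-downFrom⁻)
open import Data.List.Properties
  using (length-++; length-map; length-tabulate; filter-++; filter-accept)
open import Data.List.Relation.Unary.All as All using ()
open import Data.List.Relation.Unary.All.Properties using (¬Any⇒All¬)
open import Data.List.Relation.Unary.AllPairs as AllPairs using ()
open import Data.List.Relation.Unary.Any as Any using (here; there)
open import Data.List.Relation.Unary.Any.Properties using (lookup-index)
open import Data.List.Relation.Unary.Unique.Propositional using (Unique)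
import Data.List.Relation.Unary.Unique.Propositional.Properties as Unique
open import Data.Nat.Base
  using (ℕ; zero; suc; pred; _+_; _*_; _^_; _∸_; _%_; _≤_; _<_; z≤n; s≤s; NonZero; >-nonZero; >-nonZero⁻¹)
open import Data.Nat.DivMod
  using (_mod_; m<n⇒m%n≡m; m%n<n; m%n%n≡m%n; [m+n]%n≡m%n; %-distribˡ-+)
import Data.Nat.Properties as ℕ
open import Data.Nat.Tactic.RingSolver using (solve-∀)
open import Data.Product using (Σ-syntax; _×_; _,_; proj₁; proj₂)
open import Data.Product.Properties using (≡-dec)
open import Data.Rational.Base as ℚ using (ℚ; 0ℚ)
import Data.Rational.Properties as ℚ
import Data.Rational.Unnormalised.Base as ℚᵘ
import Data.Rational.Unnormalised.Properties as ℚᵘ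
open import Data.Sum.Base using (_⊎_; inj₁; inj₂)
open import Function.Base using (_∘_; id)
open import Function.Bundles using (Equivalence)
open import Relation.Binary.Construct.Add.Supremum.NonStrict _≤_ using (_≤⁺_; [_])
open import Relation.Binary.Definitions using (DecidableEquality; tri<; tri≈; tri>)
open import Relation.Binary.PropositionalEquality
  using (_≡_; _≢_; refl; sym; trans; cong; cong₂; subst; subst₂; module ≡-Reasoning)
open import Relation.Nullary using (¬_; Dec; yes; no; does; contradiction; ¬?; _×-dec_; _→-dec_)
open import Relation.Nullary.Construct.Add.Supremum using ([_]; ⊤⁺)
open import Relation.Nullary.Decidable using (⌊_⌋; toWitness; fromWitness; dec-true; dec-false)
open import Relation.Unary using (Decidable)

-- The graph is an obstacle product. Outer graph: cells (x , y) of a planar box, with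
-- directions j acting by the vectors (i_j , i_j²), which are in strictly convex position,
-- so that m steps in direction j form the only shortest route between their endpoints.
-- Inner graph, in every cell: a butterfly network on words of length s over D letters,
-- whose layer l → l + 1 may change letter l only, so that a first-layer word and a
-- last-layer word are joined by exactly one path of length s. A direction j is a pair
-- (w , c), and its route crosses each cell from w to w + (c , … , c); these D^(s+1)
-- crossings are edge-disjoint. Outer steps are strands of k + 1 edges, so deviating from
-- the outer route costs more than k, and a route that misses a butterfly edge pays at
-- least 2 in that cell. Hence a +k spanner keeps all but k of the m crossings of every
-- demand, that is, more than c n edges once D ≫ c and s ≫ c k, with all of D, s and the
-- number of directions constant. The box has Θ(m²) cells and there are Θ(m) demands, so
-- O(√n) demands suffice.

-- Lists, walks and edge counts

lookup-injective : ∀ {A : Set} {xs : List A} → Unique xs →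
                   ∀ i j → lookup xs i ≡ lookup xs j → i ≡ j
lookup-injective {xs = x ∷ xs} (_ AllPairs.∷ u) zero zero eq = refl
lookup-injective {xs = x ∷ xs} (x∉ AllPairs.∷ u) zero (suc j) eq =
  contradiction eq (All.lookup x∉ (∈-lookup j))
lookup-injective {xs = x ∷ xs} (x∉ AllPairs.∷ u) (suc i) zero eq =
  contradiction (sym eq) (All.lookup x∉ (∈-lookup i))
lookup-injective {xs = x ∷ xs} (_ AllPairs.∷ u) (suc i) (suc j) eq =
  cong suc (lookup-injective u i j eq)

-- Sending an index of `xs` to the position of its image in `ys` is an injection of finite sets.
-- Injectivity of `f` is asked on members only, because arcs are told apart only inside the box.
unique-length-≤ : ∀ {A B : Set} {xs : List A} {ys : List B} (f : A → B) → Unique xs →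
  (∀ {x} → x ∈ xs → f x ∈ ys) →
  (∀ {x x′} → x ∈ xs → x′ ∈ xs → f x ≡ f x′ → x ≡ x′) →
  length xs ≤ length ys
unique-length-≤ {xs = xs} {ys} f uniq into inj = Fin.injective⇒≤ position-injective
  where
  position : Fin (length xs) → Fin (length ys)
  position i = Any.index (into (∈-lookup i))
  position-injective : ∀ {i j} → position i ≡ position j → i ≡ j
  position-injective {i} {j} eq = lookup-injective uniq i j
    (inj (∈-lookup i) (∈-lookup j)
      (trans (lookup-index (into (∈-lookup i)))
        (trans (cong (lookup ys) eq) (sym (lookup-index (into (∈-lookup j)))))))

module _ {A : Set} (_≟_ : DecidableEquality A) where

  open import Data.List.Membership.DecPropositional _≟_ using (_∈?_)

  -- While `ys` is longer, some member of it is missing from `xs`; otherwise `unique-length-≤` would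
  -- bound `ys` by `xs`. This pads the demands to a prescribed number.
  unique-extend : ∀ d {xs ys : List A} → Unique xs → Unique ys → d + length xs ≤ length ys →
    Σ[ zs ∈ List A ] Unique zs × length zs ≡ d + length xs × (∀ {x} → x ∈ xs → x ∈ zs)
  unique-extend zero {xs} ux uy le = xs , ux , refl , λ x∈ → x∈
  unique-extend (suc d) {xs} {ys} ux uy le with Any.any? (λ y → ¬? (y ∈? xs)) ys
  ... | no none = contradiction le (ℕ.<⇒≱ (s≤s (ℕ.≤-trans
          (unique-length-≤ (λ y → y) uy covered (λ _ _ eq → eq)) (ℕ.m≤n+m _ d))))
    where
    covered : ∀ {y} → y ∈ ys → y ∈ xs
    covered {y} y∈ with y ∈? xs
    ... | yes y∈xs = y∈xs
    ... | no  y∉xs = contradiction (Any.map (λ { refl → y∉xs }) y∈) none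
  ... | yes new with y , _ , y∉xs ← find new
    with zs , uz , lz , sub ← unique-extend d (¬Any⇒All¬ xs y∉xs AllPairs.∷ ux) uy
           (subst (_≤ length ys) (sym (ℕ.+-suc d (length xs))) le)
    = zs , uz , trans lz (ℕ.+-suc d (length xs)) , sub ∘ there

length-filter-map : ∀ {A B : Set} {P : B → Set} (P? : Decidable P) (f : A → B) xs →
  length (filter P? (map f xs)) ≡ length (filter (P? ∘ f) xs)
length-filter-map P? f [] = refl
length-filter-map P? f (x ∷ xs) with does (P? (f x))
... | Bool.true  = cong suc (length-filter-map P? f xs)
... | Bool.false = length-filter-map P? f xs

length-filter-cartesianProduct : ∀ {A B : Set} {P : A × B → Set} (P? : Decidable P) xs ys {c} →
  (∀ x → x ∈ xs → c ≤ length (filter (λ y → P? (x , y)) ys)) →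
  length xs * c ≤ length (filter P? (cartesianProduct xs ys))
length-filter-cartesianProduct P? [] ys h = z≤n
length-filter-cartesianProduct P? (x ∷ xs) ys {c} h = begin
  c + length xs * c
    ≤⟨ ℕ.+-mono-≤ (h x (here refl)) (length-filter-cartesianProduct P? xs ys (λ x′ → h x′ ∘ there)) ⟩
  length (filter (λ y → P? (x , y)) ys) + length (filter P? (cartesianProduct xs ys))
    ≡⟨ cong (_+ _) (sym (length-filter-map P? (x ,_) ys)) ⟩
  length (filter P? (map (x ,_) ys)) + length (filter P? (cartesianProduct xs ys))
    ≡⟨ sym (length-++ (filter P? (map (x ,_) ys))) ⟩
  length (filter P? (map (x ,_) ys) ++ filter P? (cartesianProduct xs ys))
    ≡⟨ cong length (sym (filter-++ P? (map (x ,_) ys) _)) ⟩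
  length (filter P? (map (x ,_) ys ++ cartesianProduct xs ys)) ∎
  where open ℕ.≤-Reasoning

length-cartesianProduct : ∀ {A B : Set} (xs : List A) (ys : List B) →
  length (cartesianProduct xs ys) ≡ length xs * length ys
length-cartesianProduct []       ys = refl
length-cartesianProduct (x ∷ xs) ys = trans (length-++ (map (x ,_) ys))
  (cong₂ _+_ (length-map (x ,_) ys) (length-cartesianProduct xs ys))

-- The orientation in which `edges` lists an undirected edge.
sort₂ : ∀ {n} → Fin n × Fin n → Fin n × Fin n
sort₂ (a , b) with a Fin.<? b
... | yes _ = a , b
... | no  _ = b , a

sort₂-cases : ∀ {n} {a b c d : Fin n} → sort₂ (a , b) ≡ sort₂ (c , d) →
              (a ≡ c × b ≡ d) ⊎ (a ≡ d × b ≡ c)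
sort₂-cases {a = a} {b} {c} {d} eq with a Fin.<? b | c Fin.<? d
... | yes _ | yes _ = inj₁ (cong proj₁ eq , cong proj₂ eq)
... | yes _ | no _  = inj₂ (cong proj₁ eq , cong proj₂ eq)
... | no _  | yes _ = inj₂ (cong proj₂ eq , cong proj₁ eq)
... | no _  | no _  = inj₁ (cong proj₂ eq , cong proj₁ eq)

sort₂∈edges : ∀ {n} (G : Graph n) {a b} → Adj G a b → sort₂ (a , b) ∈ edges G
sort₂∈edges {n} G {a} {b} ab with a Fin.<? b
... | yes a<b = ∈-filter⁺ _ (∈-cartesianProduct⁺ (∈-allFin a) (∈-allFin b)) (a<b , ab)
... | no a≮b with Fin.<-cmp a b
...   | tri< a<b _ _ = contradiction a<b a≮b
...   | tri≈ _ refl _ = ⊥-elim (subst T (irrfl G a) ab)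
...   | tri> _ _ b<a = ∈-filter⁺ _ (∈-cartesianProduct⁺ (∈-allFin b) (∈-allFin a))
                         (b<a , subst T (symm G a b) ab)

-- A walk in `G` bounds the distance in `G`, so the stretch condition makes the distance in `H`
-- finite, and a shortest walk of `H` is the witness.
walk-within-stretch : ∀ {n} {G H : Graph n} {s t k l} →
  dist H s t ≤⁺ dist G s t +∞ k → Walk G s t l → Σ[ l′ ∈ ℕ ] l′ ≤ l + k × Walk H s t l′
walk-within-stretch {G = G} {H} {s} {t} {k} {l} stretch w
  with dist G s t | dist-isDist G s t
... | ⊤⁺    | ¬walk = contradiction w (¬walk l)
... | [ d ] | _ , d-min with dist H s t | dist-isDist H s t | stretch
...   | [ d′ ] | w′ , _ | [ d′≤ ] = d′ , ℕ.≤-trans d′≤ (ℕ.+-monoˡ-≤ k (d-min l w)) , w′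

infixr 5 _◅◅_
_◅◅_ : ∀ {n} {G : Graph n} {s u t k l} → Walk G s u k → Walk G u t l → Walk G s t (k + l)
_◅◅_ {G = G} = _++ʷ_ G

walk-along : ∀ {n} {G : Graph n} (u : ℕ → Fin n) l →
  (∀ i → i < l → Adj G (u i) (u (suc i))) → Walk G (u 0) (u l) l
walk-along u zero    h = []
walk-along u (suc l) h = h 0 (s≤s z≤n) ∷ walk-along (u ∘ suc) l (λ i i<l → h (suc i) (s≤s i<l))

-- Residues and squares

toℕ-mod : ∀ m n .⦃ _ : NonZero n ⦄ → toℕ (m mod n) ≡ m % n
toℕ-mod m n = Fin.toℕ-fromℕ< (m%n<n m n)

toℕ-mod-< : ∀ {m n} .⦃ _ : NonZero n ⦄ → m < n → toℕ (m mod n) ≡ m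
toℕ-mod-< {m} {n} m<n = trans (toℕ-mod m n) (m<n⇒m%n≡m m<n)

mod-toℕ : ∀ {n} .⦃ _ : NonZero n ⦄ (i : Fin n) → toℕ i mod n ≡ i
mod-toℕ i = Fin.toℕ-injective (toℕ-mod-< (Fin.toℕ<n i))

finToFun-injective : ∀ {m} n {w w′ : Fin (m ^ n)} → (∀ t → finToFun w t ≡ finToFun w′ t) → w ≡ w′
finToFun-injective {m} n {w} {w′} eq =
  trans (sym (Fin.funToFin-finToFin {n} {m} w)) (trans (funToFin-cong n eq) (Fin.funToFin-finToFin {n} {m} w′))
  where
  funToFin-cong : ∀ n {f g : Fin n → Fin m} → (∀ t → f t ≡ g t) → funToFin f ≡ funToFin g
  funToFin-cong zero    eq = refl
  funToFin-cong (suc n) eq = cong₂ combine (eq zero) (funToFin-cong n (eq ∘ suc))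

module _ {D : ℕ} .⦃ _ : NonZero D ⦄ where

  rotate : Fin D → Fin D → Fin D
  rotate a c = (toℕ a + toℕ c) mod D

  rotate-comm : ∀ a c → rotate a c ≡ rotate c a
  rotate-comm a c = cong (_mod D) (ℕ.+-comm (toℕ a) (toℕ c))

  rotate-injectiveʳ : ∀ {a c c′} → rotate a c ≡ rotate a c′ → c ≡ c′
  rotate-injectiveʳ {a} {c} {c′} eq = trans (sym (undo c)) (trans (cong (λ b → (D ∸ toℕ a + toℕ b) mod D) eq) (undo c′))
    where
    -- Adding `D ∸ toℕ a`, the inverse of `a` modulo `D`, recovers `c`.
    undo : ∀ c → (D ∸ toℕ a + toℕ (rotate a c)) mod D ≡ c
    undo c = Fin.toℕ-injective (begin
      toℕ ((D ∸ toℕ a + toℕ (rotate a c)) mod D)  ≡⟨ toℕ-mod _ D ⟩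
      (D ∸ toℕ a + toℕ (rotate a c)) % D          ≡⟨ cong (λ b → (D ∸ toℕ a + b) % D) (toℕ-mod _ D) ⟩
      (D ∸ toℕ a + (toℕ a + toℕ c) % D) % D       ≡⟨ %-distribˡ-+ (D ∸ toℕ a) _ D ⟩
      ((D ∸ toℕ a) % D + (toℕ a + toℕ c) % D % D) % D
        ≡⟨ cong (λ b → ((D ∸ toℕ a) % D + b) % D) (m%n%n≡m%n (toℕ a + toℕ c) D) ⟩
      ((D ∸ toℕ a) % D + (toℕ a + toℕ c) % D) % D ≡⟨ %-distribˡ-+ (D ∸ toℕ a) _ D ⟨
      (D ∸ toℕ a + (toℕ a + toℕ c)) % D           ≡⟨ cong (_% D) (ℕ.+-assoc (D ∸ toℕ a) (toℕ a) (toℕ c)) ⟨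
      (D ∸ toℕ a + toℕ a + toℕ c) % D
        ≡⟨ cong (λ b → (b + toℕ c) % D) (ℕ.m∸n+n≡m (ℕ.<⇒≤ (Fin.toℕ<n a))) ⟩
      (D + toℕ c) % D                             ≡⟨ cong (_% D) (ℕ.+-comm D (toℕ c)) ⟩
      (toℕ c + D) % D                             ≡⟨ [m+n]%n≡m%n (toℕ c) D ⟩
      toℕ c % D                                   ≡⟨ m<n⇒m%n≡m (Fin.toℕ<n c) ⟩
      toℕ c                                       ∎)
      where open ≡-Reasoning

  rotate-injectiveˡ : ∀ {a a′ c} → rotate a c ≡ rotate a′ c → a ≡ a′
  rotate-injectiveˡ {a} {a′} {c} eq =
    rotate-injectiveʳ {c} (trans (rotate-comm c a) (trans eq (rotate-comm a′ c)))

≤-by : ∀ {u v : ℤ} a → 0ℤ ℤ.≤ a → v ≡ u ℤ.+ a → u ℤ.≤ v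
≤-by {u} a 0≤a refl = subst (ℤ._≤ u ℤ.+ a) (ℤ.+-identityʳ u) (ℤ.+-monoʳ-≤ u 0≤a)

-- The offset `o` cancels, and `e` is the absolute difference of `a` and `b`.
square-difference : ∀ o {a b d} → a < d → b < d →
  Σ[ e ∈ ℕ ] e ≤ d × (+ (o + a) ℤ.- + (o + b)) ℤ.* (+ (o + a) ℤ.- + (o + b)) ≡ + (e * e)
square-difference o {a} {b} {d} a<d b<d with ℕ.≤-total a b
... | inj₁ a≤b with e , refl ← ℕ.m≤n⇒∃[o]m+o≡n a≤b =
      e , ℕ.≤-trans (ℕ.m≤n+m e a) (ℕ.<⇒≤ b<d) ,
      trans (identity (+ o) (+ a) (+ e)) (sym (ℤ.pos-* e e))
  where
  identity : ∀ o a e → ((o ℤ.+ a) ℤ.- (o ℤ.+ (a ℤ.+ e))) ℤ.* ((o ℤ.+ a) ℤ.- (o ℤ.+ (a ℤ.+ e))) ≡ e ℤ.* e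
  identity = ℤSolver.solve-∀
... | inj₂ b≤a with e , refl ← ℕ.m≤n⇒∃[o]m+o≡n b≤a =
      e , ℕ.≤-trans (ℕ.m≤n+m e b) (ℕ.<⇒≤ a<d) ,
      trans (identity (+ o) (+ b) (+ e)) (sym (ℤ.pos-* e e))
  where
  identity : ∀ o b e → ((o ℤ.+ (b ℤ.+ e)) ℤ.- (o ℤ.+ b)) ℤ.* ((o ℤ.+ (b ℤ.+ e)) ℤ.- (o ℤ.+ b)) ≡ e ℤ.* e
  identity = ℤSolver.solve-∀

-- `e` is the absolute difference. This is `(i - j)² ≥ 0` with its equality case, free of
-- subtraction: the strict convexity of the parabola.
square-sum : ∀ i j → Σ[ e ∈ ℕ ] i * i + j * j ≡ 2 * i * j + e * e × (e ≡ 0 → i ≡ j)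
square-sum i j with ℕ.≤-total i j
... | inj₁ i≤j with e , refl ← ℕ.m≤n⇒∃[o]m+o≡n i≤j =
      e , identity i e , λ { refl → sym (ℕ.+-identityʳ i) }
  where
  identity : ∀ i e → i * i + (i + e) * (i + e) ≡ 2 * i * (i + e) + e * e
  identity = solve-∀
... | inj₂ j≤i with e , refl ← ℕ.m≤n⇒∃[o]m+o≡n j≤i =
      e , identity j e , λ { refl → ℕ.+-identityʳ j }
  where
  identity : ∀ j e → (j + e) * (j + e) + j * j ≡ 2 * (j + e) * j + e * e
  identity = solve-∀

division-< : ∀ {a a′ f f′ i o} → a < o → o ≤ i → f < f′ → a + f * i < a′ + f′ * i
division-< {a} {a′} {f} {f′} {i} a<o o≤i f<f′ = ℕ.<-≤-trans (ℕ.+-monoˡ-< (f * i) (ℕ.<-≤-trans a<o o≤i))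
  (ℕ.≤-trans (ℕ.*-monoˡ-≤ i f<f′) (ℕ.m≤n+m (f′ * i) a′))

-- Quotient and remainder on division by `i`. The common bound `o` on remainders stands apart from
-- `i` since it will be a lower bound for all slopes.
division-unique : ∀ {a a′ f f′ i o} → a < o → a′ < o → o ≤ i → a + f * i ≡ a′ + f′ * i → a ≡ a′ × f ≡ f′
division-unique {a} {a′} {f} {f′} {i} a<o a′<o o≤i eq with ℕ.<-cmp f f′
... | tri< f<f′ _ _ = contradiction eq (ℕ.<⇒≢ (division-< a<o o≤i f<f′))
... | tri≈ _ refl _ = ℕ.+-cancelʳ-≡ (f * i) a a′ eq , refl
... | tri> _ _ f′<f = contradiction (sym eq) (ℕ.<⇒≢ (division-< a′<o o≤i f′<f))

-- The obstacle product

module Obstacles (D s R X Y : ℕ)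
  ⦃ _ : NonZero D ⦄ ⦃ _ : NonZero R ⦄ ⦃ _ : NonZero X ⦄ ⦃ _ : NonZero Y ⦄ where

  Word : Set
  Word = Fin (D ^ s)

  digit : Word → Fin s → Fin D
  digit = finToFun

  Δ : ℕ
  Δ = D ^ s * D

  Dir : Set
  Dir = Fin Δ

  -- Direction (w , c) enters a cell at the word w and leaves it at w + (c , … , c).
  tail : Dir → Word
  tail j = quotient D j

  shift : Dir → Fin D
  shift j = remainder {D ^ s} D j

  dir-injective : ∀ {j j′} → tail j ≡ tail j′ → shift j ≡ shift j′ → j ≡ j′
  dir-injective {j} {j′} p q =
    trans (sym (Fin.combine-remQuot {D ^ s} D j)) (trans (cong₂ combine p q) (Fin.combine-remQuot {D ^ s} D j′))

  lap : ℕ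
  lap = s + suc R

  instance
    lap-nonZero : NonZero lap
    lap-nonZero = >-nonZero (ℕ.≤-trans (s≤s z≤n) (ℕ.m≤n+m (suc R) s))

  -- The offset lap * Δ yields lap * (i - j)² ≤ i² for all slopes i and j, which is what keeps
  -- the potential below from dropping along an up-edge.
  slope : Dir → ℕ
  slope j = lap * Δ + toℕ j

  slope-injective : ∀ {j j′} → slope j ≡ slope j′ → j ≡ j′
  slope-injective eq = Fin.toℕ-injective (ℕ.+-cancelˡ-≡ (lap * Δ) _ _ eq)

  -- The crossing of a cell in direction `j`, layer by layer: `track j 0` is the entry word and
  -- `track j s` the exit word.
  track : Dir → ℕ → Word
  track j l = funToFin λ t → if does (toℕ t ℕ.<? l) then rotate (digit (tail j) t) (shift j) else digit (tail j) t

  digit-track-< : ∀ j {l t} → toℕ t < l → digit (track j l) t ≡ rotate (digit (tail j) t) (shift j)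
  digit-track-< j {l} {t} t<l = trans (Fin.finToFun-funToFin _ t)
    (cong (if_then rotate (digit (tail j) t) (shift j) else digit (tail j) t) (dec-true (toℕ t ℕ.<? l) t<l))

  digit-track-≥ : ∀ j {l t} → l ≤ toℕ t → digit (track j l) t ≡ digit (tail j) t
  digit-track-≥ j {l} {t} l≤t = trans (Fin.finToFun-funToFin _ t)
    (cong (if_then rotate (digit (tail j) t) (shift j) else digit (tail j) t) (dec-false (toℕ t ℕ.<? l) (ℕ.≤⇒≯ l≤t)))

  -- Edge-disjointness of the crossings. Letter `t` before and after the edge reveals the shift;
  -- undoing it on the letters below `t` and reading off the others gives the tail.
  track-injective : ∀ {j j′} (t : Fin s) → track j (toℕ t) ≡ track j′ (toℕ t) →
                    track j (suc (toℕ t)) ≡ track j′ (suc (toℕ t)) → j ≡ j′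
  track-injective {j} {j′} t w≡ w′≡ = dir-injective tail≡ shift≡
    where
    tail-at : digit (tail j) t ≡ digit (tail j′) t
    tail-at = trans (sym (digit-track-≥ j ℕ.≤-refl)) (trans (cong (λ w → digit w t) w≡) (digit-track-≥ j′ ℕ.≤-refl))
    shift≡ : shift j ≡ shift j′
    shift≡ = rotate-injectiveʳ {a = digit (tail j) t} (trans (sym (digit-track-< j ℕ.≤-refl))
      (trans (cong (λ w → digit w t) w′≡) (trans (digit-track-< j′ ℕ.≤-refl)
        (cong (λ d → rotate d (shift j′)) (sym tail-at)))))
    tail≡ : tail j ≡ tail j′
    tail≡ = finToFun-injective s λ u → digit≡ u (toℕ u ℕ.<? toℕ t)
      where
      digit≡ : ∀ u → Dec (toℕ u < toℕ t) → digit (tail j) u ≡ digit (tail j′) u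
      digit≡ u (yes u<t) = rotate-injectiveˡ {c = shift j} (trans (sym (digit-track-< j u<t))
        (trans (cong (λ w → digit w u) w≡) (trans (digit-track-< j′ u<t) (cong (rotate (digit (tail j′) u)) (sym shift≡)))))
      digit≡ u (no u≮t) = trans (sym (digit-track-≥ j (ℕ.≮⇒≥ u≮t)))
        (trans (cong (λ w → digit w u) w≡) (digit-track-≥ j′ (ℕ.≮⇒≥ u≮t)))

  -- bf x y l w is the word w in layer l of the butterfly of cell (x , y); st x y j r is
  -- interior vertex r of the strand leaving that cell in direction j. Coordinates are
  -- unbounded here: encode reduces them modulo their ranges, and is faithful on Valid.
  data Vertex : Set where
    bf : (x y l : ℕ) → Word → Vertex
    st : (x y : ℕ) → Dir → (r : ℕ) → Vertex

  data Valid : Vertex → Set where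
    bf : ∀ {x y l w} → x < X → y < Y → l ≤ s → Valid (bf x y l w)
    st : ∀ {x y j r} → x < X → y < Y → r < R → Valid (st x y j r)

  -- Numbering of the vertices.

  order : ℕ
  order = (X * Y) * (suc s * D ^ s + Δ * R)

  code : ℕ → ℕ → Fin (suc s * D ^ s) ⊎ Fin (Δ * R) → Fin order
  code x y node = combine (combine (x mod X) (y mod Y)) (join _ _ node)

  encode : Vertex → Fin order
  encode (bf x y l w) = code x y (inj₁ (combine (l mod suc s) w))
  encode (st x y j r) = code x y (inj₂ (combine j (r mod R)))

  decodeNode : ℕ → ℕ → Fin (suc s * D ^ s) ⊎ Fin (Δ * R) → Vertex
  decodeNode x y (inj₁ i) = bf x y (toℕ (quotient {suc s} (D ^ s) i)) (remainder {suc s} (D ^ s) i)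
  decodeNode x y (inj₂ i) = st x y (quotient R i) (toℕ (remainder {Δ} R i))

  decode : Fin order → Vertex
  decode a = decodeNode (toℕ (quotient {X} Y cell)) (toℕ (remainder {X} Y cell)) (splitAt (suc s * D ^ s) node)
    where
    cell = quotient {X * Y} (suc s * D ^ s + Δ * R) a
    node = remainder {X * Y} (suc s * D ^ s + Δ * R) a

  -- No validity is involved: `decode` lands within the ranges, where the reductions in `encode` do
  -- nothing. Hence any walk on `Fin order` can be read as a sequence of vertices.
  encode-decode : ∀ a → encode (decode a) ≡ a
  encode-decode a = trans (encode-decodeNode _ _ (splitAt (suc s * D ^ s) node))
    (trans (cong₂ combine
      (trans (cong₂ combine (mod-toℕ _) (mod-toℕ _)) (Fin.combine-remQuot {X} Y cell))
      (Fin.join-splitAt (suc s * D ^ s) (Δ * R) node))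
    (Fin.combine-remQuot {X * Y} (suc s * D ^ s + Δ * R) a))
    where
    cell = quotient {X * Y} (suc s * D ^ s + Δ * R) a
    node = remainder {X * Y} (suc s * D ^ s + Δ * R) a
    encode-decodeNode : ∀ x y i → encode (decodeNode x y i) ≡ code x y i
    encode-decodeNode x y (inj₁ i) = cong (code x y ∘ inj₁)
      (trans (cong (λ l → combine {suc s} l (remainder {suc s} (D ^ s) i)) (mod-toℕ (quotient {suc s} (D ^ s) i))) (Fin.combine-remQuot {suc s} (D ^ s) i))
    encode-decodeNode x y (inj₂ i) = cong (code x y ∘ inj₂)
      (trans (cong (combine {Δ} {R} (quotient R i)) (mod-toℕ (remainder {Δ} R i))) (Fin.combine-remQuot {Δ} R i))

  decode-code : ∀ {x y} → x < X → y < Y → ∀ i → decode (code x y i) ≡ decodeNode x y i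
  decode-code {x} {y} x<X y<Y i = begin
    decode (code x y i)
      ≡⟨ cong (λ (c , v) → decodeNode (toℕ (quotient {X} Y c)) (toℕ (remainder {X} Y c)) (splitAt (suc s * D ^ s) v))
              (Fin.remQuot-combine {X * Y} {suc s * D ^ s + Δ * R} (combine (x mod X) (y mod Y)) (join _ _ i)) ⟩
    decodeNode (toℕ (quotient {X} Y (combine (x mod X) (y mod Y)))) (toℕ (remainder {X} Y (combine (x mod X) (y mod Y))))
               (splitAt (suc s * D ^ s) (join _ _ i))
      ≡⟨ cong₂ (λ (a , b) v → decodeNode (toℕ a) (toℕ b) v) (Fin.remQuot-combine {X} {Y} (x mod X) (y mod Y))
               (Fin.splitAt-join (suc s * D ^ s) (Δ * R) i) ⟩
    decodeNode (toℕ (x mod X)) (toℕ (y mod Y)) i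
      ≡⟨ cong₂ (λ a b → decodeNode a b i) (toℕ-mod-< x<X) (toℕ-mod-< y<Y) ⟩
    decodeNode x y i ∎
    where open ≡-Reasoning

  decode-encode : ∀ {v} → Valid v → decode (encode v) ≡ v
  decode-encode {bf x y l w} (bf x< y< l≤) = trans (decode-code x< y< _)
    (trans (cong (λ (a , b) → bf x y (toℕ a) b) (Fin.remQuot-combine {suc s} {D ^ s} (l mod suc s) w))
           (cong (λ a → bf x y a w) (toℕ-mod-< (s≤s l≤))))
  decode-encode {st x y j r} (st x< y< r<) = trans (decode-code x< y< _)
    (trans (cong (λ (a , b) → st x y a (toℕ b)) (Fin.remQuot-combine {Δ} {R} j (r mod R)))
           (cong (st x y j) (toℕ-mod-< r<)))

  encode-injective : ∀ {u v} → Valid u → Valid v → encode u ≡ encode v → u ≡ v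
  encode-injective pu pv eq = trans (sym (decode-encode pu)) (trans (cong decode eq) (decode-encode pv))

  -- Coordinates are compared without reduction, so a strand that would leave the box has no far end
  -- instead of wrapping around. With `R` interior vertices a strand has `suc R` edges.
  Up : Vertex → Vertex → Set
  Up (bf x y l w) (bf x′ y′ l′ w′) =
    x′ ≡ x × y′ ≡ y × l′ ≡ suc l × (∀ t → toℕ t ≢ l → digit w′ t ≡ digit w t)
  Up (bf x y l w) (st x′ y′ j r) = x′ ≡ x × y′ ≡ y × l ≡ s × r ≡ 0 × w ≡ track j s
  Up (st x y j r) (st x′ y′ j′ r′) = x′ ≡ x × y′ ≡ y × j′ ≡ j × r′ ≡ suc r
  Up (st x y j r) (bf x′ y′ l w) =
    x′ ≡ x + slope j × y′ ≡ y + slope j * slope j × suc r ≡ R × l ≡ 0 × w ≡ track j 0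

  up? : ∀ u v → Dec (Up u v)
  up? (bf x y l w) (bf x′ y′ l′ w′) =
    (x′ ℕ.≟ x) ×-dec (y′ ℕ.≟ y) ×-dec (l′ ℕ.≟ suc l) ×-dec
    Fin.all? (λ t → ¬? (toℕ t ℕ.≟ l) →-dec (digit w′ t Fin.≟ digit w t))
  up? (bf x y l w) (st x′ y′ j r) =
    (x′ ℕ.≟ x) ×-dec (y′ ℕ.≟ y) ×-dec (l ℕ.≟ s) ×-dec (r ℕ.≟ 0) ×-dec (w Fin.≟ track j s)
  up? (st x y j r) (st x′ y′ j′ r′) =
    (x′ ℕ.≟ x) ×-dec (y′ ℕ.≟ y) ×-dec (j′ Fin.≟ j) ×-dec (r′ ℕ.≟ suc r)
  up? (st x y j r) (bf x′ y′ l w) =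
    (x′ ℕ.≟ x + slope j) ×-dec (y′ ℕ.≟ y + slope j * slope j) ×-dec
    (suc r ℕ.≟ R) ×-dec (l ℕ.≟ 0) ×-dec (w Fin.≟ track j 0)

  up-irrefl : ∀ v → ¬ Up v v
  up-irrefl (bf x y l w) (_ , _ , l≡1+l , _) = ℕ.1+n≢n (sym l≡1+l)
  up-irrefl (st x y j r) (_ , _ , _ , r≡1+r) = ℕ.1+n≢n (sym r≡1+r)

  obstacleGraph : Graph order
  obstacleGraph .adj a b = ⌊ up? (decode a) (decode b) ⌋ ∨ ⌊ up? (decode b) (decode a) ⌋
  obstacleGraph .symm a b = ∨-comm ⌊ up? (decode a) (decode b) ⌋ _
  obstacleGraph .irrfl a with up? (decode a) (decode a)
  ... | yes up = ⊥-elim (up-irrefl (decode a) up)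
  ... | no  _  = refl

  adj⇒up : ∀ {a b} → Adj obstacleGraph a b → Up (decode a) (decode b) ⊎ Up (decode b) (decode a)
  adj⇒up {a} {b} ab with Equivalence.to (T-∨ {⌊ up? (decode a) (decode b) ⌋}) ab
  ... | inj₁ up   = inj₁ (toWitness {a? = up? (decode a) (decode b)} up)
  ... | inj₂ down = inj₂ (toWitness {a? = up? (decode b) (decode a)} down)

  up⇒adj : ∀ {u v} → Valid u → Valid v → Up u v → Adj obstacleGraph (encode u) (encode v)
  up⇒adj {u} {v} pu pv up = Equivalence.from T-∨
    (inj₁ (fromWitness {a? = up? _ _} (subst₂ Up (sym (decode-encode pu)) (sym (decode-encode pv)) up)))

  -- No up-edge lowers this potential or raises it by more than scale, and every edge of a
  -- route in direction j₀ raises it by exactly scale: a certificate that j₀-routes are shortest.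
  module Potential (j₀ : Dir) where

    i : ℕ
    i = slope j₀

    scale : ℤ
    scale = + (i * i * suc R)

    -- A lap in direction `j` raises `height` by `suc R * lap * (i² - (i - j)²)`, where `i` and `j`
    -- are slopes. This is `lap * scale` minus `suc R * gap j`, and the loss is spread evenly over
    -- the `suc R` edges of the strand.
    gap : Dir → ℤ
    gap j = + lap ℤ.* ((+ i ℤ.- + slope j) ℤ.* (+ i ℤ.- + slope j))

    height : ℕ → ℕ → ℤ
    height x y = + suc R ℤ.* + lap ℤ.* (+ 2 ℤ.* + i ℤ.* + x ℤ.- + y)

    potential : Vertex → ℤ
    potential (bf x y l w) = height x y ℤ.+ scale ℤ.* + l
    potential (st x y j r) = height x y ℤ.+ scale ℤ.* (+ s ℤ.+ + suc r) ℤ.- gap j ℤ.* + suc r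

    0≤scale : 0ℤ ℤ.≤ scale
    0≤scale = ℤ.+≤+ z≤n

    0≤gap : ∀ j → 0ℤ ℤ.≤ gap j
    0≤gap j with e , _ , eq ← square-difference (lap * Δ) (Fin.toℕ<n j₀) (Fin.toℕ<n j)
      rewrite eq | sym (ℤ.pos-* lap (e * e)) = ℤ.+≤+ z≤n

    gap≤scale : ∀ j → gap j ℤ.≤ scale
    gap≤scale j with e , e≤Δ , eq ← square-difference (lap * Δ) (Fin.toℕ<n j₀) (Fin.toℕ<n j)
      rewrite eq | sym (ℤ.pos-* lap (e * e)) = ℤ.+≤+ (begin
        lap * (e * e)          ≤⟨ ℕ.*-mono-≤ (ℕ.m≤m*n lap lap) (ℕ.*-mono-≤ e≤Δ e≤Δ) ⟩
        lap * lap * (Δ * Δ)    ≡⟨ ℕ.[m*n]*[o*p]≡[m*o]*[n*p] lap lap Δ Δ ⟩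
        lap * Δ * (lap * Δ)    ≤⟨ ℕ.*-mono-≤ (ℕ.m≤m+n (lap * Δ) (toℕ j₀)) (ℕ.m≤m+n (lap * Δ) (toℕ j₀)) ⟩
        i * i                  ≤⟨ ℕ.m≤m*n (i * i) (suc R) ⟩
        i * i * suc R          ∎)
      where open ℕ.≤-Reasoning

    0≤scale-gap : ∀ j → 0ℤ ℤ.≤ scale ℤ.- gap j
    0≤scale-gap j = ℤ.i≤j⇒0≤j-i (gap≤scale j)

    private
      step-identity : ∀ h c l → h ℤ.+ c ℤ.* (+ 1 ℤ.+ l) ≡ h ℤ.+ c ℤ.* l ℤ.+ c
      step-identity = ℤSolver.solve-∀
      exit-identity : ∀ h c s g → h ℤ.+ c ℤ.* (s ℤ.+ + 1) ℤ.- g ℤ.* + 1 ≡ h ℤ.+ c ℤ.* s ℤ.+ (c ℤ.- g)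
      exit-identity = ℤSolver.solve-∀
      strand-identity : ∀ h c s g r → h ℤ.+ c ℤ.* (s ℤ.+ (+ 1 ℤ.+ (+ 1 ℤ.+ r))) ℤ.- g ℤ.* (+ 1 ℤ.+ (+ 1 ℤ.+ r)) ≡
                h ℤ.+ c ℤ.* (s ℤ.+ (+ 1 ℤ.+ r)) ℤ.- g ℤ.* (+ 1 ℤ.+ r) ℤ.+ (c ℤ.- g)
      strand-identity = ℤSolver.solve-∀
      enter-identity : ∀ i j x y s R c → c ≡ i ℤ.* i ℤ.* (+ 1 ℤ.+ R) →
        let L = s ℤ.+ (+ 1 ℤ.+ R)
            g = L ℤ.* ((i ℤ.- j) ℤ.* (i ℤ.- j)) in
        (+ 1 ℤ.+ R) ℤ.* L ℤ.* (+ 2 ℤ.* i ℤ.* (x ℤ.+ j) ℤ.- (y ℤ.+ j ℤ.* j)) ℤ.+ c ℤ.* + 0 ≡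
        (+ 1 ℤ.+ R) ℤ.* L ℤ.* (+ 2 ℤ.* i ℤ.* x ℤ.- y) ℤ.+ c ℤ.* (s ℤ.+ R) ℤ.- g ℤ.* R ℤ.+ (c ℤ.- g)
      enter-identity i j x y s R c refl = identity i j x y s R
        where
        identity : ∀ i j x y s R →
          (+ 1 ℤ.+ R) ℤ.* (s ℤ.+ (+ 1 ℤ.+ R)) ℤ.* (+ 2 ℤ.* i ℤ.* (x ℤ.+ j) ℤ.- (y ℤ.+ j ℤ.* j)) ℤ.+ i ℤ.* i ℤ.* (+ 1 ℤ.+ R) ℤ.* + 0 ≡
          (+ 1 ℤ.+ R) ℤ.* (s ℤ.+ (+ 1 ℤ.+ R)) ℤ.* (+ 2 ℤ.* i ℤ.* x ℤ.- y) ℤ.+ i ℤ.* i ℤ.* (+ 1 ℤ.+ R) ℤ.* (s ℤ.+ R)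
          ℤ.- (s ℤ.+ (+ 1 ℤ.+ R)) ℤ.* ((i ℤ.- j) ℤ.* (i ℤ.- j)) ℤ.* R
          ℤ.+ (i ℤ.* i ℤ.* (+ 1 ℤ.+ R) ℤ.- (s ℤ.+ (+ 1 ℤ.+ R)) ℤ.* ((i ℤ.- j) ℤ.* (i ℤ.- j)))
        identity = ℤSolver.solve-∀
      add-back : ∀ u c g → u ℤ.+ c ≡ u ℤ.+ (c ℤ.- g) ℤ.+ g
      add-back = ℤSolver.solve-∀

    rise : ∀ u v j → potential v ≡ potential u ℤ.+ (scale ℤ.- gap j) →
           potential u ℤ.≤ potential v × potential v ℤ.≤ potential u ℤ.+ scale
    rise u v j eq = ≤-by (scale ℤ.- gap j) (0≤scale-gap j) eq ,
      ≤-by (gap j) (0≤gap j) (trans (add-back (potential u) scale (gap j)) (cong (ℤ._+ gap j) (sym eq)))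

    potential-up : ∀ u v → Up u v → potential u ℤ.≤ potential v × potential v ℤ.≤ potential u ℤ.+ scale
    potential-up (bf x y l w) (bf _ _ _ w′) (refl , refl , refl , _) =
      ≤-by scale 0≤scale (step-identity (height x y) scale (+ l)) ,
      ℤ.≤-reflexive (step-identity (height x y) scale (+ l))
    potential-up u@(bf x y l w) v@(st _ _ j _) (refl , refl , refl , refl , _) =
      rise u v j (exit-identity (height x y) scale (+ s) (gap j))
    potential-up u@(st x y j r) v@(st _ _ _ _) (refl , refl , refl , refl) =
      rise u v j (strand-identity (height x y) scale (+ s) (gap j) (+ r))
    potential-up u@(st x y j r) v@(bf _ _ _ _) (refl , refl , 1+r≡R , refl , _) =
      rise u v j (trans
        (cong (λ t → + suc R ℤ.* + lap ℤ.* (+ 2 ℤ.* + i ℤ.* + (x + slope j) ℤ.- (+ y ℤ.+ t)) ℤ.+ scale ℤ.* + 0)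
              (ℤ.pos-* (slope j) (slope j)))
        (trans (enter-identity (+ i) (+ slope j) (+ x) (+ y) (+ s) (+ R) scale
                 (trans (ℤ.pos-* (i * i) (suc R)) (cong (ℤ._* + suc R) (ℤ.pos-* i i))))
               (cong (λ t → height x y ℤ.+ scale ℤ.* (+ s ℤ.+ + t) ℤ.- gap j ℤ.* + t ℤ.+ (scale ℤ.- gap j)) (sym 1+r≡R))))

  -- Routes in a fixed direction.

  module Route (j₀ : Dir) (x₀ y₀ : ℕ) where

    open Potential j₀

    waypoint : ℕ → ℕ → Vertex
    waypoint f l = bf (x₀ + f * i) (y₀ + f * (i * i)) l (track j₀ l)

    i>0 : 0 < i
    i>0 = ℕ.≤-trans (ℕ.≤-trans (s≤s z≤n) (Fin.toℕ<n j₀)) (ℕ.≤-trans (ℕ.m≤n*m Δ lap) (ℕ.m≤m+n (lap * Δ) (toℕ j₀)))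

    instance
      i-nonZero : NonZero i
      i-nonZero = >-nonZero i>0

    -- Each lap adds `2 i² - i² = i²` to `2 i x - y`, hence `lap * scale` to the potential.
    potential-waypoint : ∀ m → potential (waypoint m 0) ≡ potential (waypoint 0 0) ℤ.+ scale ℤ.* + (m * lap)
    potential-waypoint m = trans
      (cong₂ (λ t u → + suc R ℤ.* + lap ℤ.* (+ 2 ℤ.* + i ℤ.* (+ x₀ ℤ.+ t) ℤ.- (+ y₀ ℤ.+ u)) ℤ.+ scale ℤ.* + 0)
             (ℤ.pos-* m i) (trans (ℤ.pos-* m (i * i)) (cong (+ m ℤ.*_) (ℤ.pos-* i i))))
      (trans (identity (+ suc R) (+ lap) (+ i) (+ x₀) (+ y₀) (+ m) scale
               (trans (ℤ.pos-* (i * i) (suc R)) (cong (ℤ._* + suc R) (ℤ.pos-* i i))))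
             (cong (λ t → potential (waypoint 0 0) ℤ.+ scale ℤ.* t) (sym (ℤ.pos-* m lap))))
      where
      identity : ∀ K L i x y m c → c ≡ i ℤ.* i ℤ.* K →
        K ℤ.* L ℤ.* (+ 2 ℤ.* i ℤ.* (x ℤ.+ m ℤ.* i) ℤ.- (y ℤ.+ m ℤ.* (i ℤ.* i))) ℤ.+ c ℤ.* + 0 ≡
        K ℤ.* L ℤ.* (+ 2 ℤ.* i ℤ.* (x ℤ.+ + 0) ℤ.- (y ℤ.+ + 0)) ℤ.+ c ℤ.* + 0 ℤ.+ c ℤ.* (m ℤ.* L)
      identity K L i x y m c refl = expand K L i x y m
        where
        expand : ∀ K L i x y m →
          K ℤ.* L ℤ.* (+ 2 ℤ.* i ℤ.* (x ℤ.+ m ℤ.* i) ℤ.- (y ℤ.+ m ℤ.* (i ℤ.* i))) ℤ.+ i ℤ.* i ℤ.* K ℤ.* + 0 ≡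
          K ℤ.* L ℤ.* (+ 2 ℤ.* i ℤ.* (x ℤ.+ + 0) ℤ.- (y ℤ.+ + 0)) ℤ.+ i ℤ.* i ℤ.* K ℤ.* + 0 ℤ.+ i ℤ.* i ℤ.* K ℤ.* (m ℤ.* L)
        expand = ℤSolver.solve-∀

    lap-walk : ∀ f → x₀ + suc f * i < X → y₀ + suc f * (i * i) < Y →
      Walk obstacleGraph (encode (waypoint f 0)) (encode (waypoint (suc f) 0)) lap
    lap-walk f x< y< = subst (Walk obstacleGraph _ _) length-lap (butterfly ◅◅ leave ∷ strand ◅◅ arrive ∷ [])
      where
      x = x₀ + f * i
      y = y₀ + f * (i * i)
      x<X : x < X
      x<X = ℕ.≤-<-trans (ℕ.+-monoʳ-≤ x₀ (ℕ.m≤n+m (f * i) i)) x<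
      y<Y : y < Y
      y<Y = ℕ.≤-<-trans (ℕ.+-monoʳ-≤ y₀ (ℕ.m≤n+m (f * (i * i)) (i * i))) y<
      pred-R<R : pred R < R
      pred-R<R = ℕ.≤-reflexive (ℕ.suc-pred R)
      agree : ∀ l u → toℕ u ≢ l → digit (track j₀ (suc l)) u ≡ digit (track j₀ l) u
      agree l u u≢l with toℕ u ℕ.<? l
      ... | yes u<l = trans (digit-track-< j₀ (ℕ.m<n⇒m<1+n u<l)) (sym (digit-track-< j₀ u<l))
      ... | no u≮l = trans (digit-track-≥ j₀ (ℕ.≤∧≢⇒< (ℕ.≮⇒≥ u≮l) (λ l≡u → u≢l (sym l≡u))))
                           (sym (digit-track-≥ j₀ (ℕ.≮⇒≥ u≮l)))
      butterfly : Walk obstacleGraph (encode (waypoint f 0)) (encode (waypoint f s)) s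
      butterfly = walk-along (λ l → encode (waypoint f l)) s λ l l<s →
        up⇒adj (bf x<X y<Y (ℕ.<⇒≤ l<s)) (bf x<X y<Y l<s) (refl , refl , refl , agree l)
      leave : Adj obstacleGraph (encode (waypoint f s)) (encode (st x y j₀ 0))
      leave = up⇒adj (bf x<X y<Y ℕ.≤-refl) (st x<X y<Y (ℕ.≤-<-trans z≤n pred-R<R)) (refl , refl , refl , refl , refl)
      strand : Walk obstacleGraph (encode (st x y j₀ 0)) (encode (st x y j₀ (pred R))) (pred R)
      strand = walk-along (λ r → encode (st x y j₀ r)) (pred R) λ r r< →
        up⇒adj (st x<X y<Y (ℕ.<-trans r< pred-R<R)) (st x<X y<Y (ℕ.≤-<-trans r< pred-R<R)) (refl , refl , refl , refl)
      arrive : Adj obstacleGraph (encode (st x y j₀ (pred R))) (encode (waypoint (suc f) 0))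
      arrive = up⇒adj (st x<X y<Y pred-R<R) (bf x< y< z≤n) (next x₀ f i , next y₀ f (i * i) , ℕ.suc-pred R , refl , refl)
        where
        next : ∀ x f i → x + suc f * i ≡ x + f * i + i
        next = solve-∀
      -- `s` butterfly edges, one edge onto the strand, `pred R` inside it and one off it.
      length-lap : s + suc (pred R + 1) ≡ lap
      length-lap = cong (λ r → s + suc r) (trans (ℕ.+-comm (pred R) 1) (ℕ.suc-pred R))

    laps-walk : ∀ f → x₀ + f * i < X → y₀ + f * (i * i) < Y →
      Walk obstacleGraph (encode (waypoint 0 0)) (encode (waypoint f 0)) (f * lap)
    laps-walk zero    _  _  = []
    laps-walk (suc f) x< y< = subst (Walk obstacleGraph _ _) (ℕ.+-comm (f * lap) lap)
      (laps-walk f (ℕ.≤-<-trans (ℕ.+-monoʳ-≤ x₀ (ℕ.m≤n+m (f * i) i)) x<)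
                   (ℕ.≤-<-trans (ℕ.+-monoʳ-≤ y₀ (ℕ.m≤n+m (f * (i * i)) (i * i))) y<)
       ◅◅ lap-walk f x< y<)

    -- What a short walk in a subgraph must contain.

    module Passes (H : Graph order) where

      KeptBelow : ℕ → ℕ → Set
      KeptBelow f l = ∀ {t} → t < l → Adj H (encode (waypoint f t)) (encode (waypoint f (suc t)))

      kept? : ∀ f → Dec (KeptBelow f s)
      kept? f = ℕ.allUpTo? (λ t → T? (adj H (encode (waypoint f t)) (encode (waypoint f (suc t))))) s

      -- `downFrom` puts pass `f` at the head for `suc f`, so one more pass is a single step of
      -- `filter`.
      kept : ℕ → List ℕ
      kept f = filter kept? (downFrom f)

      #kept : ℕ → ℕ
      #kept f = length (kept f)

      #kept-suc : ∀ f → #kept f ≤ #kept (suc f)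
      #kept-suc f with kept? f
      ... | yes _ = ℕ.n≤1+n _
      ... | no _  = ℕ.≤-refl

      #kept-accept : ∀ {f} → KeptBelow f s → #kept (suc f) ≡ suc (#kept f)
      #kept-accept {f} k = cong length (filter-accept kept? {xs = downFrom f} k)

      -- The functional 2 i x - y takes the value 2 i j - j² = i² - (i - j)² on direction j, hence
      -- at most i², with equality for j₀ only: after f crossings the deficit f i² - (2 i x - y),
      -- measured from the source, is positive unless all of them were in direction j₀.
      Ahead : ℕ → ℕ → ℕ → Set
      Ahead x y f = 2 * i * x + y₀ < f * (i * i) + 2 * i * x₀ + y

      -- In `on`, the `d` descents pay for every earlier pass missing from `H` and for one more: the
      -- current pass is already written off, whatever the walk does in this cell.
      data Settled (x y f d : ℕ) : Set where
        ahead : Ahead x y f → Settled x y f d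
        on    : x ≡ x₀ + f * i → y ≡ y₀ + f * (i * i) → suc f ≤ #kept f + d → Settled x y f d

      -- The current pass is accounted for only if the walk leaves by the strand of `j₀`. On another
      -- strand it either completes the crossing and is `Ahead`, or turns back by a descent that
      -- pays.
      Leaving : ℕ → ℕ → Dir → ℕ → ℕ → Set
      Leaving x y j f d = Ahead x y f ⊎
        (x ≡ x₀ + f * i × y ≡ y₀ + f * (i * i) × f ≤ #kept f + d × (j ≡ j₀ → suc f ≤ #kept (suc f) + d))

      -- State v l d: what a walk of length l from the source to v, with d of its steps going
      -- down and no strand crossed backwards, can have done; f counts the strands crossed.
      -- backward: the walk has entered the strand from its far end, whose state is recorded.
      data State : Vertex → ℕ → ℕ → Set where
        settled  : ∀ {x y t w l d} f → l ≡ lap * f + t + 2 * d → Settled x y f d → State (bf x y t w) l d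
        tracking : ∀ {x y t w l d} f → l ≡ lap * f + t + 2 * d →
                   x ≡ x₀ + f * i → y ≡ y₀ + f * (i * i) → f ≤ #kept f + d →
                   (∀ u → t ≤ toℕ u → digit w u ≡ digit (tail j₀) u) →
                   (w ≡ track j₀ t → KeptBelow f t) → State (bf x y t w) l d
        forward  : ∀ {x y j r l d} f → l ≡ lap * f + (s + suc r) + 2 * d →
                   Leaving x y j f d →
                   State (st x y j r) l d
        backward : ∀ {x y j r l d} f → l + R ≡ lap * f + r + 2 * d → R ≤ d + r →
                   Settled (x + slope j) (y + slope j * slope j) f d → State (st x y j r) l d

      settle : ∀ {x y f d} → Settled x y f d → Settled x y f (suc d)
      settle (ahead δ)        = ahead δ
      settle {f = f} {d} (on x≡ y≡ f<) = on x≡ y≡ (ℕ.≤-trans f< (ℕ.+-monoʳ-≤ (#kept f) (ℕ.n≤1+n d)))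

      -- The extra descent pays for the current pass.
      settle-≤ : ∀ {x y f d} → x ≡ x₀ + f * i → y ≡ y₀ + f * (i * i) → f ≤ #kept f + d → Settled x y f (suc d)
      settle-≤ {f = f} {d} x≡ y≡ f≤ = on x≡ y≡ (subst (suc f ≤_) (sym (ℕ.+-suc (#kept f) d)) (s≤s f≤))

      -- The deficit grows by `i² - 2 i j + j² = (i - j)²`, with `j` standing for its slope.
      ahead-cross : ∀ {x y f} j → Ahead x y f → Ahead (x + slope j) (y + slope j * slope j) (suc f)
      ahead-cross {x} {y} {f} j δ with e , eq , _ ← square-sum i (slope j) = begin
        suc (2 * i * (x + slope j) + y₀)            ≡⟨ lhs i x (slope j) y₀ ⟩
        suc (2 * i * x + y₀) + 2 * i * slope j      ≤⟨ ℕ.+-mono-≤ δ (ℕ.≤-trans (ℕ.m≤m+n _ (e * e)) (ℕ.≤-reflexive (sym eq))) ⟩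
        f * (i * i) + 2 * i * x₀ + y + (i * i + slope j * slope j)
                                                    ≡⟨ rhs (f * (i * i)) (2 * i * x₀) y (i * i) (slope j * slope j) ⟩
        suc f * (i * i) + 2 * i * x₀ + (y + slope j * slope j) ∎
        where
        open ℕ.≤-Reasoning
        lhs : ∀ i x j y₀ → suc (2 * i * (x + j) + y₀) ≡ suc (2 * i * x + y₀) + 2 * i * j
        lhs = solve-∀
        rhs : ∀ a b y p q → a + b + y + (p + q) ≡ p + a + b + (y + q)
        rhs = solve-∀

      -- Here the growth `(i - j)²` of the deficit is positive, since distinct directions have
      -- distinct slopes.
      on-cross : ∀ {x y f} j → j ≢ j₀ → x ≡ x₀ + f * i → y ≡ y₀ + f * (i * i) →
                 Ahead (x + slope j) (y + slope j * slope j) (suc f)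
      on-cross {f = f} j j≢ refl refl with square-sum i (slope j)
      ... | zero  , _  , e≡0⇒ = contradiction (sym (slope-injective {j₀} {j} (e≡0⇒ refl))) j≢
      ... | suc e , eq , _    = begin
        suc (2 * i * (x₀ + f * i + slope j) + y₀)
          ≡⟨ lhs i x₀ f (slope j) y₀ ⟩
        suc (2 * i * slope j) + (2 * i * x₀ + 2 * (f * (i * i)) + y₀)
          ≤⟨ ℕ.+-monoˡ-≤ _ (subst (suc (2 * i * slope j) ≤_) (sym eq)
               (subst (_≤ 2 * i * slope j + suc e * suc e) (ℕ.+-comm (2 * i * slope j) 1)
                      (ℕ.+-monoʳ-≤ (2 * i * slope j) (s≤s z≤n)))) ⟩
        i * i + slope j * slope j + (2 * i * x₀ + 2 * (f * (i * i)) + y₀)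
          ≡⟨ rhs (i * i) (slope j * slope j) (2 * i * x₀) (f * (i * i)) y₀ ⟩
        suc f * (i * i) + 2 * i * x₀ + (y₀ + f * (i * i) + slope j * slope j) ∎
        where
        open ℕ.≤-Reasoning
        lhs : ∀ i x₀ f j y₀ → suc (2 * i * (x₀ + f * i + j) + y₀) ≡
              suc (2 * i * j) + (2 * i * x₀ + 2 * (f * (i * i)) + y₀)
        lhs = solve-∀
        rhs : ∀ p q b a y₀ → p + q + (b + 2 * a + y₀) ≡ p + a + b + (y₀ + a + q)
        rhs = solve-∀

      private
        up-length : ∀ {a t b l} → l ≡ a + t + b → suc l ≡ a + suc t + b
        up-length {a} {t} {b} refl = cong (_+ b) (sym (ℕ.+-suc a t))

        exit-length : ∀ {a t b l} → l ≡ a + t + b → suc l ≡ a + (t + 1) + b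
        exit-length {a} {t} {b} refl = identity a t b
          where
          identity : ∀ a t b → suc (a + t + b) ≡ a + (t + 1) + b
          identity = solve-∀

        down-length : ∀ {a t d l} → l ≡ a + suc t + 2 * d → suc l ≡ a + t + 2 * suc d
        down-length {a} {t} {d} refl = identity a t d
          where
          identity : ∀ a t d → suc (a + suc t + 2 * d) ≡ a + t + 2 * suc d
          identity = solve-∀

        wrap-length : ∀ {f r d l} → suc r ≡ R → l ≡ lap * f + (s + suc r) + 2 * d → suc l ≡ lap * suc f + 0 + 2 * d
        wrap-length {f} {r} {d} refl refl = identity s r f d
          where
          identity : ∀ s r f d → suc ((s + suc (suc r)) * f + (s + suc r) + 2 * d) ≡
                     (s + suc (suc r)) * suc f + 0 + 2 * d
          identity = solve-∀

        return-length : ∀ {a r b l} → suc r ≡ R → l + R ≡ a + r + b → suc l ≡ a + 0 + b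
        return-length {a} {r} {b} {l} refl eq = ℕ.+-cancelʳ-≡ r _ _ (trans (sym (ℕ.+-suc l r)) (trans eq (identity a r b)))
          where
          identity : ∀ a r b → a + r + b ≡ a + 0 + b + r
          identity = solve-∀

        retreat-length : ∀ {a r d l} → suc r ≡ R → l ≡ a + 0 + 2 * d → suc l + R ≡ a + r + 2 * suc d
        retreat-length {a} {r} {d} refl refl = identity a r d
          where
          identity : ∀ a r d → suc (a + 0 + 2 * d) + suc r ≡ a + r + 2 * suc d
          identity = solve-∀

      step-up : ∀ {l d} u v → Up u v → Adj H (encode u) (encode v) → State u l d → State v (suc l) d
      step-up (bf x y t w) (bf _ _ _ w′) (refl , refl , refl , _) uv (settled f eq σ) =
        settled f (up-length {lap * f} eq) σ
      step-up (bf x y t w) (bf _ _ _ w′) (refl , refl , refl , same) uv (tracking f eq refl refl f≤ rest low) =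
        tracking f (up-length {lap * f} eq) refl refl f≤
          (λ u t<u → trans (same u (λ { refl → ℕ.<-irrefl refl t<u })) (rest u (ℕ.<⇒≤ t<u)))
          (λ w′≡ → extend w′≡ (unstep w′≡))
        where
        -- Uniqueness of upward paths in the butterfly: this edge may change letter `t` only, and by
        -- `rest` that letter was still the one of the tail.
        unstep : w′ ≡ track j₀ (suc t) → w ≡ track j₀ t
        unstep refl = finToFun-injective s agree
          where
          agree : ∀ u → digit w u ≡ digit (track j₀ t) u
          agree u with toℕ u ℕ.<? t
          ... | yes u<t = trans (sym (same u (λ { refl → ℕ.<-irrefl refl u<t })))
                  (trans (digit-track-< j₀ (ℕ.<-trans u<t (ℕ.n<1+n t))) (sym (digit-track-< j₀ u<t)))
          ... | no u≮t = trans (rest u (ℕ.≮⇒≥ u≮t)) (sym (digit-track-≥ j₀ (ℕ.≮⇒≥ u≮t)))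
        extend : w′ ≡ track j₀ (suc t) → w ≡ track j₀ t → KeptBelow f (suc t)
        extend refl refl {t′} t′<1+t with ℕ.m<1+n⇒m<n∨m≡n t′<1+t
        ... | inj₁ t′<t = low refl t′<t
        ... | inj₂ refl = uv
      step-up (bf x y t w) (st _ _ j _) (refl , refl , refl , refl , _) uv (settled f eq σ) =
        forward f (exit-length {lap * f} eq) (relax σ)
        where
        relax : ∀ {d} → Settled x y f d → Leaving x y j f d
        relax (ahead δ) = inj₁ δ
        relax {d} (on x≡ y≡ f<) = inj₂ (x≡ , y≡ , ℕ.<⇒≤ f< , λ _ → ℕ.≤-trans f< (ℕ.+-monoˡ-≤ d (#kept-suc f)))
      step-up {d = d} (bf x y t w) (st _ _ j _) (refl , refl , refl , refl , w≡) uv (tracking f eq x≡ y≡ f≤ _ low) =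
        forward f (exit-length {lap * f} eq)
          -- The strand of `j₀` is left from the word `track j₀ s`, to which only the route's own
          -- path leads upwards; so pass `f` is in `H`.
          (inj₂ (x≡ , y≡ , f≤ , λ { refl → subst (λ q → suc f ≤ q + d) (sym (#kept-accept (low w≡))) (s≤s f≤) }))
      step-up {d = d} (st x y j r) (st _ _ _ _) (refl , refl , refl , refl) uv (forward {l = l} f eq σ) =
        forward f (subst (λ t → suc l ≡ lap * f + t + 2 * d) (sym (ℕ.+-suc s (suc r))) (up-length {lap * f} eq)) σ
      step-up {d = d} (st x y j r) (st _ _ _ _) (refl , refl , refl , refl) uv (backward f eq R≤ σ) =
        backward f (up-length {lap * f} eq) (ℕ.≤-trans R≤ (ℕ.+-monoʳ-≤ d (ℕ.n≤1+n r))) σ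
      step-up {d = d} (st x y j r) (bf _ _ _ _) (refl , refl , 1+r≡R , refl , _) uv (forward f eq (inj₁ δ)) =
        settled (suc f) (wrap-length {f} {r} {d} 1+r≡R eq) (ahead (ahead-cross {x} {y} {f} j δ))
      step-up {d = d} (st x y j r) (bf _ _ _ _) (refl , refl , 1+r≡R , refl , refl) uv
              (forward f eq (inj₂ (x≡ , y≡ , _ , reached))) with j Fin.≟ j₀
      ... | no j≢j₀ = settled (suc f) (wrap-length {f} {r} {d} 1+r≡R eq) (ahead (on-cross {f = f} j j≢j₀ x≡ y≡))
      -- The next cell is entered at `track j₀ 0`, so tracking restarts in layer 0 with no edges to
      -- account for.
      ... | yes refl = tracking (suc f) (wrap-length {f} {r} {d} 1+r≡R eq)
                         (trans (cong (_+ i) x≡) (next x₀ f i)) (trans (cong (_+ i * i) y≡) (next y₀ f (i * i)))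
                         (reached refl) (λ _ → digit-track-≥ j₀) (λ _ ())
        where
        next : ∀ x f i → x + f * i + i ≡ x + suc f * i
        next = solve-∀
      step-up {d = d} (st x y j r) (bf _ _ _ _) (refl , refl , 1+r≡R , refl , _) uv (backward f eq _ σ) =
        settled f (return-length {lap * f} {r} 1+r≡R eq) σ

      -- A descent inside a butterfly settles the current pass, and one along a strand only
      -- increases the credit `d`. The first alternative arises only when a strand has been crossed
      -- backwards in full.
      step-down : ∀ {l d} u v → Up u v → State v l d → suc R ≤ suc d ⊎ State u (suc l) (suc d)
      step-down (bf x y t w) (bf _ _ _ _) (refl , refl , refl , _) (settled f eq σ) =
        inj₂ (settled f (down-length {lap * f} eq) (settle σ))
      step-down (bf x y t w) (bf _ _ _ _) (refl , refl , refl , _) (tracking f eq x≡ y≡ f≤ _ _) =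
        inj₂ (settled f (down-length {lap * f} eq) (settle-≤ x≡ y≡ f≤))
      step-down {d = d} (bf x y t w) (st _ _ j _) (refl , refl , refl , refl , _) (forward {l = l} f eq σ) =
        inj₂ (settled f (down-length {lap * f} (subst (λ t → l ≡ lap * f + t + 2 * d) (ℕ.+-comm s 1) eq)) (clear σ))
        where
        clear : Leaving x y j f d → Settled x y f (suc d)
        clear (inj₁ δ) = ahead δ
        clear (inj₂ (x≡ , y≡ , f≤ , _)) = settle-≤ x≡ y≡ f≤
      -- At `r = 0` the walk has already made `R` descents, and this step adds one.
      step-down {d = d} (bf x y t w) (st _ _ j _) (refl , refl , refl , refl , _) (backward f _ R≤d _) =
        inj₁ (s≤s (subst (R ≤_) (ℕ.+-identityʳ d) R≤d))
      step-down {d = d} (st x y j r) (st _ _ _ _) (refl , refl , refl , refl) (forward {l = l} f eq σ) =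
        inj₂ (forward f (down-length {lap * f} (subst (λ t → l ≡ lap * f + t + 2 * d) (ℕ.+-suc s (suc r)) eq)) (widen σ))
        where
        widen : Leaving x y j f d → Leaving x y j f (suc d)
        widen (inj₁ δ) = inj₁ δ
        widen (inj₂ (x≡ , y≡ , f≤ , reached)) =
          inj₂ (x≡ , y≡ , ℕ.≤-trans f≤ (ℕ.+-monoʳ-≤ (#kept f) (ℕ.n≤1+n d)) ,
                λ j≡ → ℕ.≤-trans (reached j≡) (ℕ.+-monoʳ-≤ (#kept (suc f)) (ℕ.n≤1+n d)))
      step-down {d = d} (st x y j r) (st _ _ _ _) (refl , refl , refl , refl) (backward f eq R≤ σ) =
        inj₂ (backward f (down-length {lap * f} eq) (subst (R ≤_) (ℕ.+-suc d r) R≤) (settle σ))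
      step-down {d = d} (st x y j r) (bf _ _ _ _) (refl , refl , 1+r≡R , refl , _) (settled f eq σ) =
        inj₂ (backward f (retreat-length {lap * f} {r} 1+r≡R eq)
               (subst (_≤ suc d + r) 1+r≡R (s≤s (ℕ.m≤n+m r d))) (settle σ))
      step-down {d = d} (st x y j r) (bf _ _ _ _) (refl , refl , 1+r≡R , refl , _) (tracking f eq x≡ y≡ f≤ _ _) =
        inj₂ (backward f (retreat-length {lap * f} {r} 1+r≡R eq)
               (subst (_≤ suc d + r) 1+r≡R (s≤s (ℕ.m≤n+m r d))) (settle-≤ x≡ y≡ f≤))

      -- An upward step gains at most `scale` and a downward one nothing, which gives the
      -- inequality. It is maintained even once `State` is lost, so that it can exclude large `d` at
      -- the end.
      Reached : Vertex → ℕ → Set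
      Reached v l = Σ[ d ∈ ℕ ] potential v ℤ.+ scale ℤ.* + d ℤ.≤ potential (waypoint 0 0) ℤ.+ scale ℤ.* + l ×
                               (suc R ≤ d ⊎ State v l d)

      reached-source : Reached (waypoint 0 0) 0
      reached-source = 0 , ℤ.≤-refl , inj₂ (tracking 0 (lap*0 lap) refl refl z≤n
                                            (λ _ → digit-track-≥ j₀) (λ _ ()))
        where
        lap*0 : ∀ a → 0 ≡ a * 0 + 0 + 0
        lap*0 = solve-∀

      private
        collect : ∀ a c l → a ℤ.+ c ℤ.* l ℤ.+ c ≡ a ℤ.+ c ℤ.* (+ 1 ℤ.+ l)
        collect = ℤSolver.solve-∀

      reached-up : ∀ {l} u v → Up u v → Adj H (encode u) (encode v) → Reached u l → Reached v (suc l)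
      reached-up {l} u v up uv (d , bound , state) = d , bound′ , step state
        where
        step : suc R ≤ d ⊎ State u l d → suc R ≤ d ⊎ State v (suc l) d
        step (inj₁ K≤d) = inj₁ K≤d
        step (inj₂ σ)   = inj₂ (step-up u v up uv σ)
        swap : ∀ a c d → a ℤ.+ c ℤ.+ d ≡ a ℤ.+ d ℤ.+ c
        swap = ℤSolver.solve-∀
        bound′ : potential v ℤ.+ scale ℤ.* + d ℤ.≤ potential (waypoint 0 0) ℤ.+ scale ℤ.* + suc l
        bound′ = begin
          potential v ℤ.+ scale ℤ.* + d                 ≤⟨ ℤ.+-monoˡ-≤ _ (proj₂ (potential-up u v up)) ⟩
          potential u ℤ.+ scale ℤ.+ scale ℤ.* + d       ≡⟨ swap (potential u) scale (scale ℤ.* + d) ⟩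
          potential u ℤ.+ scale ℤ.* + d ℤ.+ scale       ≤⟨ ℤ.+-monoˡ-≤ scale bound ⟩
          potential (waypoint 0 0) ℤ.+ scale ℤ.* + l ℤ.+ scale   ≡⟨ collect (potential (waypoint 0 0)) scale (+ l) ⟩
          potential (waypoint 0 0) ℤ.+ scale ℤ.* + suc l         ∎
          where open ℤ.≤-Reasoning

      reached-down : ∀ {l} u v → Up u v → Reached v l → Reached u (suc l)
      reached-down {l} u v up (d , bound , state) = suc d , bound′ , step state
        where
        step : suc R ≤ d ⊎ State v l d → suc R ≤ suc d ⊎ State u (suc l) (suc d)
        step (inj₁ K≤d) = inj₁ (ℕ.m≤n⇒m≤1+n K≤d)
        step (inj₂ σ)   = step-down u v up σ
        bound′ : potential u ℤ.+ scale ℤ.* + suc d ℤ.≤ potential (waypoint 0 0) ℤ.+ scale ℤ.* + suc l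
        bound′ = begin
          potential u ℤ.+ scale ℤ.* + suc d             ≤⟨ ℤ.+-monoˡ-≤ _ (proj₁ (potential-up u v up)) ⟩
          potential v ℤ.+ scale ℤ.* + suc d             ≡⟨ collect (potential v) scale (+ d) ⟨
          potential v ℤ.+ scale ℤ.* + d ℤ.+ scale       ≤⟨ ℤ.+-monoˡ-≤ scale bound ⟩
          potential (waypoint 0 0) ℤ.+ scale ℤ.* + l ℤ.+ scale   ≡⟨ collect (potential (waypoint 0 0)) scale (+ l) ⟩
          potential (waypoint 0 0) ℤ.+ scale ℤ.* + suc l         ∎
          where open ℤ.≤-Reasoning

      -- The target lies `m * lap * scale` above the source in potential; cancel `scale`. With
      -- stretch at most `R` this yields `d ≤ R`.
      distance-bound : ∀ {m d l} →
        potential (waypoint m 0) ℤ.+ scale ℤ.* + d ℤ.≤ potential (waypoint 0 0) ℤ.+ scale ℤ.* + l →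
        m * lap + d ≤ l
      distance-bound {m} {d} {l} bound = ℤ.drop‿+≤+ (ℤ.*-cancelʳ-≤-pos (+ (m * lap + d)) (+ l) scale
        (subst₂ ℤ._≤_
          (trans (cong (λ t → ℤ.- potential (waypoint 0 0) ℤ.+ (t ℤ.+ scale ℤ.* + d)) (potential-waypoint m))
                 (left (potential (waypoint 0 0)) scale (+ (m * lap)) (+ d)))
          (right (potential (waypoint 0 0)) scale (+ l))
          (ℤ.+-monoʳ-≤ (ℤ.- potential (waypoint 0 0)) bound)))
        where
        left : ∀ a c t d → ℤ.- a ℤ.+ (a ℤ.+ c ℤ.* t ℤ.+ c ℤ.* d) ≡ (t ℤ.+ d) ℤ.* c
        left = ℤSolver.solve-∀
        right : ∀ a c l → ℤ.- a ℤ.+ (a ℤ.+ c ℤ.* l) ≡ l ℤ.* c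
        right = ℤSolver.solve-∀
        instance
          scale-positive : ℤ.Positive scale
          scale-positive = ℤ.positive (ℤ.+<+ (ℕ.*-mono-≤ (ℕ.*-mono-≤ i>0 i>0) (s≤s (z≤n {R}))))

      -- One surplus lap costs `lap`, which exceeds `R`.
      laps-match : ∀ {m f d l} → l ≤ m * lap + R → l ≡ lap * f + 0 + 2 * d → ¬ m < f
      laps-match {m} {f} {d} {l} l≤ eq m<f = ℕ.<-irrefl refl (begin-strict
        m * lap + R      <⟨ ℕ.+-monoʳ-< (m * lap) (ℕ.m≤n+m (suc R) s) ⟩
        m * lap + lap    ≡⟨ ℕ.+-comm (m * lap) lap ⟩
        suc m * lap      ≤⟨ ℕ.*-monoˡ-≤ lap m<f ⟩
        f * lap          ≡⟨ ℕ.*-comm f lap ⟩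
        lap * f          ≤⟨ ℕ.≤-trans (ℕ.m≤m+n _ 0) (ℕ.m≤m+n _ (2 * d)) ⟩
        lap * f + 0 + 2 * d ≡⟨ eq ⟨
        l                ≤⟨ l≤ ⟩
        m * lap + R      ∎)
        where open ℕ.≤-Reasoning

      -- At waypoint `m` the deficit is `(f - m) * i²`.
      ahead-laps : ∀ {m f} → Ahead (x₀ + m * i) (y₀ + m * (i * i)) f → m < f
      ahead-laps {m} {f} δ = ℕ.*-cancelʳ-< (i * i) m f (ℕ.+-cancelʳ-< (2 * i * x₀ + y₀ + m * (i * i)) _ _
        (subst₂ _≤_ (cong suc (left i x₀ m y₀)) (right (f * (i * i)) (2 * i * x₀) y₀ (m * (i * i))) δ))
        where
        left : ∀ i x m y → 2 * i * (x + m * i) + y ≡ m * (i * i) + (2 * i * x + y + m * (i * i))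
        left = solve-∀
        right : ∀ a b y c → a + b + (y + c) ≡ a + (b + y + c)
        right = solve-∀

      on-laps : ∀ {m f} → x₀ + m * i ≡ x₀ + f * i → m ≡ f
      on-laps {m} {f} eq = ℕ.*-cancelʳ-≡ m f i (ℕ.+-cancelˡ-≡ x₀ _ _ eq)

      module _ (H⊆G : H ⊆ᴳ obstacleGraph) where

        reached-walk : ∀ {a b l l′} → Reached (decode a) l → Walk H a b l′ → Reached (decode b) (l′ + l)
        reached-walk ρ [] = ρ
        reached-walk {a} {b} {l} ρ (_∷_ {u = u} {l = l′} au w) =
          subst (Reached (decode b)) (ℕ.+-suc l′ l) (reached-walk (move (adj⇒up (H⊆G a u au))) w)
          where
          move : Up (decode a) (decode u) ⊎ Up (decode u) (decode a) → Reached (decode u) (suc l)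
          move (inj₁ up) = reached-up (decode a) (decode u) up
            (subst₂ (Adj H) (sym (encode-decode a)) (sym (encode-decode u)) au) ρ
          move (inj₂ down) = reached-down (decode u) (decode a) down ρ

        -- Stretch at most `R` leaves `d ≤ R`, so `State` is intact. Being `Ahead` would take more
        -- than `m` laps, which is too long. Otherwise `f = m`, and the descents pay for all passes
        -- missing from `H`.
        kept-passes : ∀ {m l} → x₀ < X → y₀ < Y → x₀ + m * i < X → y₀ + m * (i * i) < Y →
          Walk H (encode (waypoint 0 0)) (encode (waypoint m 0)) l → l ≤ m * lap + R →
          m ≤ #kept m + R
        kept-passes {m} {l} x₀< y₀< x< y< w l≤ = conclude
          (subst (λ v → Reached v (l + 0)) (decode-encode (bf x< y< z≤n))
            (reached-walk (subst (λ v → Reached v 0)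
              (sym (decode-encode (bf (subst (_< X) (sym (ℕ.+-identityʳ x₀)) x₀<) (subst (_< Y) (sym (ℕ.+-identityʳ y₀)) y₀<) z≤n)))
              reached-source) w))
          where
          conclude : Reached (waypoint m 0) (l + 0) → m ≤ #kept m + R
          conclude ρ with subst (Reached (waypoint m 0)) (ℕ.+-identityʳ l) ρ
          ... | d , bound , inj₁ R<d = contradiction
                (ℕ.+-cancelˡ-≤ (m * lap) _ _ (ℕ.≤-trans (distance-bound {m} {d} {l} bound) l≤))
                (ℕ.<⇒≱ R<d)
          ... | d , bound , inj₂ (settled f eq (ahead δ)) =
                contradiction (ahead-laps {m} {f} δ) (laps-match {m} {f} {d} l≤ eq)
          ... | d , bound , inj₂ (settled f eq (on x≡ _ f<)) with refl ← on-laps {m} {f} x≡ =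
                ℕ.≤-trans (ℕ.<⇒≤ f<) (ℕ.+-monoʳ-≤ (#kept m)
                  (ℕ.+-cancelˡ-≤ (m * lap) _ _ (ℕ.≤-trans (distance-bound {m} {d} {l} bound) l≤)))
          ... | d , bound , inj₂ (tracking f eq x≡ _ f≤ _ _) with refl ← on-laps {m} {f} x≡ =
                ℕ.≤-trans f≤ (ℕ.+-monoʳ-≤ (#kept m)
                  (ℕ.+-cancelˡ-≤ (m * lap) _ _ (ℕ.≤-trans (distance-bound {m} {d} {l} bound) l≤)))

  -- Counting kept edges

  module Demands (Y₀ m : ℕ) (m>0 : 0 < m)
    (wide : ∀ {a} j → a < lap * Δ → a + m * slope j < X)
    (tall : ∀ {b} j → b < Y₀ → b + m * (slope j * slope j) < Y) where

    -- Starting abscissae stay below `lap * Δ`, a lower bound for every slope, so that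
    -- `a + f * slope j` determines `a` and `f` once `j` is known.
    Index : Set
    Index = Dir × Fin (lap * Δ) × Fin Y₀

    at : Index → ℕ → ℕ → Vertex
    at (j , a , b) = Route.waypoint j (toℕ a) (toℕ b)

    at-valid : ∀ π {f t} → f ≤ m → t ≤ s → Valid (at π f t)
    at-valid (j , a , b) f≤m t≤s = bf
      (ℕ.≤-<-trans (ℕ.+-monoʳ-≤ (toℕ a) (ℕ.*-monoˡ-≤ (slope j) f≤m)) (wide j (Fin.toℕ<n a)))
      (ℕ.≤-<-trans (ℕ.+-monoʳ-≤ (toℕ b) (ℕ.*-monoˡ-≤ (slope j * slope j) f≤m)) (tall j (Fin.toℕ<n b)))
      t≤s

    indices : List Index
    indices = cartesianProduct (allFin Δ) (cartesianProduct (allFin (lap * Δ)) (allFin Y₀))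

    indices-unique : Unique indices
    indices-unique = Unique.cartesianProduct⁺ (Unique.allFin⁺ Δ)
      (Unique.cartesianProduct⁺ (Unique.allFin⁺ (lap * Δ)) (Unique.allFin⁺ Y₀))

    length-indices : length indices ≡ Δ * (lap * Δ * Y₀)
    length-indices = trans (length-cartesianProduct (allFin Δ) _)
      (cong₂ _*_ (length-tabulate {n = Δ} id)
        (trans (length-cartesianProduct (allFin (lap * Δ)) _) (cong₂ _*_ (length-tabulate {n = lap * Δ} id) (length-tabulate {n = Y₀} id))))

    demand : Index → Fin order × Fin order
    demand π = encode (at π 0 0) , encode (at π m 0)

    bf-injective : ∀ {x x′ y y′ l l′ w w′} → bf x y l w ≡ bf x′ y′ l′ w′ → x ≡ x′ × y ≡ y′ × l ≡ l′ × w ≡ w′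
    bf-injective refl = refl , refl , refl , refl

    demand-injective : ∀ {π π′} → demand π ≡ demand π′ → π ≡ π′
    demand-injective {π@(j , a , b)} {π′@(j′ , a′ , b′)} eq = conclude
      (bf-injective (encode-injective (at-valid π z≤n z≤n) (at-valid π′ z≤n z≤n) (cong proj₁ eq)))
      (bf-injective (encode-injective (at-valid π ℕ.≤-refl z≤n) (at-valid π′ ℕ.≤-refl z≤n) (cong proj₂ eq)))
      where
      conclude : _ → _ → π ≡ π′
      conclude (x≡ , y≡ , _) (x′≡ , _)
        with refl ← Fin.toℕ-injective {i = a} {a′} (ℕ.+-cancelʳ-≡ 0 _ _ x≡)
           | refl ← Fin.toℕ-injective {i = b} {b′} (ℕ.+-cancelʳ-≡ 0 _ _ y≡)
        with refl ← slope-injective {j} {j′} (ℕ.*-cancelˡ-≡ (slope j) (slope j′) m ⦃ >-nonZero m>0 ⦄ (ℕ.+-cancelˡ-≡ (toℕ a) _ _ x′≡))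
        = refl

    demands : List (Fin order × Fin order)
    demands = map demand indices

    demands-unique : Unique demands
    demands-unique = Unique.map⁺ demand-injective indices-unique

    length-demands : length demands ≡ Δ * (lap * Δ * Y₀)
    length-demands = trans (length-map demand indices) length-indices

    arc : (Index × ℕ) × Fin s → Fin order × Fin order
    arc ((π , f) , t) = encode (at π f (toℕ t)) , encode (at π f (suc (toℕ t)))

    -- The two words give the direction by `track-injective`, the abscissa then gives `a` and `f` by
    -- division, and the ordinate gives `b`.
    arc-injective : ∀ {π π′ f f′} t t′ → f < m → f′ < m →
      at π f (toℕ t) ≡ at π′ f′ (toℕ t′) → at π f (suc (toℕ t)) ≡ at π′ f′ (suc (toℕ t′)) →
      ((π , f) , t) ≡ ((π′ , f′) , t′)
    arc-injective {j , a , b} {j′ , a′ , b′} {f} {f′} t t′ f< f′< lower upper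
      with x≡ , y≡ , t≡ , w≡ ← bf-injective lower | _ , _ , _ , w′≡ ← bf-injective upper
      with refl ← Fin.toℕ-injective {i = t} {t′} t≡
      with refl ← track-injective {j} {j′} t w≡ w′≡
      with a≡ , refl ← division-unique {f = f} {f′} (Fin.toℕ<n a) (Fin.toℕ<n a′) (ℕ.m≤m+n (lap * Δ) (toℕ j)) x≡
      with refl ← Fin.toℕ-injective {i = a} {a′} a≡
         | refl ← Fin.toℕ-injective {i = b} {b′} (ℕ.+-cancelʳ-≡ _ _ _ y≡)
      = refl

    module _ (H : Graph order) {P : List (Fin order × Fin order)}
      (demands⊆P : ∀ {d} → d ∈ demands → d ∈ P) (spanner : IsPairwiseSpanner R obstacleGraph P H) where

      open module Kept (π : Index) = Route.Passes (proj₁ π) (toℕ (proj₁ (proj₂ π))) (toℕ (proj₂ (proj₂ π))) H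
        using (KeptBelow; kept?; #kept)

      kept-bound : ∀ π → π ∈ indices → m ∸ R ≤ #kept π m
      kept-bound π@(j , a , b) π∈ with l , l≤ , w ← walk-within-stretch
          (proj₂ spanner _ _ (demands⊆P (∈-map⁺ demand π∈)))
          (Route.laps-walk j (toℕ a) (toℕ b) m (wide j (Fin.toℕ<n a)) (tall j (Fin.toℕ<n b)))
        = ℕ.m≤n+o⇒m∸n≤o m R (subst (m ≤_) (ℕ.+-comm (#kept π m) R)
            (Route.Passes.kept-passes j (toℕ a) (toℕ b) H (proj₁ spanner)
              (ℕ.≤-<-trans (ℕ.m≤m+n _ _) (wide j (Fin.toℕ<n a))) (ℕ.≤-<-trans (ℕ.m≤m+n _ _) (tall j (Fin.toℕ<n b)))
              (wide j (Fin.toℕ<n a)) (tall j (Fin.toℕ<n b)) w l≤))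

      KeptPass : Index × ℕ → Set
      KeptPass (π , f) = KeptBelow π f s

      keptPass? : Decidable KeptPass
      keptPass? (π , f) = kept? π f

      keptPasses : List (Index × ℕ)
      keptPasses = filter keptPass? (cartesianProduct indices (downFrom m))

      keptArcs : List ((Index × ℕ) × Fin s)
      keptArcs = cartesianProduct keptPasses (allFin s)

      keptArcs-unique : Unique keptArcs
      keptArcs-unique = Unique.cartesianProduct⁺
        (Unique.filter⁺ keptPass? (Unique.cartesianProduct⁺ indices-unique (Unique.downFrom⁺ m))) (Unique.allFin⁺ s)

      keptArc : ∀ {π f t} → ((π , f) , t) ∈ keptArcs → f < m × KeptBelow π f s
      keptArc {π} {f} e∈
        with π∈ , kept ← ∈-filter⁻ keptPass? {v = π , f} {cartesianProduct indices (downFrom m)}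
                           (proj₁ (∈-cartesianProduct⁻ keptPasses (allFin s) e∈))
        = ∈-downFrom⁻ (proj₂ (∈-cartesianProduct⁻ indices (downFrom m) π∈)) , kept

      sort₂-arc-injective : ∀ {e e′} → e ∈ keptArcs → e′ ∈ keptArcs → sort₂ (arc e) ≡ sort₂ (arc e′) → e ≡ e′
      sort₂-arc-injective {(π , f) , t} {(π′ , f′) , t′} e∈ e′∈ eq
        with f< , _ ← keptArc e∈ | f′< , _ ← keptArc e′∈ | sort₂-cases eq
      ... | inj₁ (lower , upper) = arc-injective {π} {π′} t t′ f< f′<
              (encode-injective (at-valid π (ℕ.<⇒≤ f<) (ℕ.<⇒≤ (Fin.toℕ<n t))) (at-valid π′ (ℕ.<⇒≤ f′<) (ℕ.<⇒≤ (Fin.toℕ<n t′))) lower)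
              (encode-injective (at-valid π (ℕ.<⇒≤ f<) (Fin.toℕ<n t)) (at-valid π′ (ℕ.<⇒≤ f′<) (Fin.toℕ<n t′)) upper)
      -- Reversed arcs cannot coincide: their layers would satisfy `t = suc t′` and `suc t = t′`.
      ... | inj₂ (lower , upper)
        with _ , _ , t≡ , _ ← bf-injective (encode-injective (at-valid π (ℕ.<⇒≤ f<) (ℕ.<⇒≤ (Fin.toℕ<n t))) (at-valid π′ (ℕ.<⇒≤ f′<) (Fin.toℕ<n t′)) lower)
           | _ , _ , t′≡ , _ ← bf-injective (encode-injective (at-valid π (ℕ.<⇒≤ f<) (Fin.toℕ<n t)) (at-valid π′ (ℕ.<⇒≤ f′<) (ℕ.<⇒≤ (Fin.toℕ<n t′))) upper)
        = contradiction t≡ (ℕ.<⇒≢ (ℕ.m<n⇒m<1+n (ℕ.≤-reflexive t′≡)))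

      -- Each demand keeps at least `m ∸ R` passes, each kept pass contributes `s` edges of `H`, and
      -- all of these are distinct.
      spanner-size : Δ * (lap * Δ * Y₀) * (m ∸ R) * s ≤ ∣E H ∣
      spanner-size = begin
        Δ * (lap * Δ * Y₀) * (m ∸ R) * s  ≡⟨ cong (λ n → n * (m ∸ R) * s) length-indices ⟨
        length indices * (m ∸ R) * s
          ≤⟨ ℕ.*-monoˡ-≤ s (length-filter-cartesianProduct keptPass? indices (downFrom m) kept-bound) ⟩
        length keptPasses * s             ≡⟨ cong (length keptPasses *_) (length-tabulate {n = s} id) ⟨
        length keptPasses * length (allFin s) ≡⟨ length-cartesianProduct keptPasses (allFin s) ⟨
        length keptArcs
          ≤⟨ unique-length-≤ (sort₂ ∘ arc) keptArcs-unique
               (λ { {(π , f) , t} e∈ → sort₂∈edges H (proj₂ (keptArc e∈) (Fin.toℕ<n t)) }) sort₂-arc-injective ⟩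
        ∣E H ∣                            ∎
        where open ℕ.≤-Reasoning

-- Choice of parameters

module Sizes (k c : ℕ) (k>0 : 0 < k) (c>0 : 0 < c) where

  -- Chosen for `cell-density`: `D > 32 c` makes `8 c (s + 1)` less than `D s / 2`, and `s ≥ 16 c k`
  -- makes `8 c D k` at most `D s / 2`. `side`, which is `lap * Δ + Δ`, bounds every slope.
  D = 32 * c + 1
  s = 16 * c * suc k
  side = suc (s + suc k) * (D ^ s * D)

  -- The number of demands divided by `m`; it depends on `k` and `c` only.
  rate : ℕ
  rate = D ^ s * D * ((s + suc k) * (D ^ s * D) * (side * side))

  instance
    D-nonZero : NonZero D
    D-nonZero = >-nonZero (ℕ.m≤n+m 1 (32 * c))
    k-nonZero : NonZero k
    k-nonZero = >-nonZero k>0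
    D^s-nonZero : NonZero (D ^ s)
    D^s-nonZero = ℕ.m^n≢0 D s
    Δ-nonZero : NonZero (D ^ s * D)
    Δ-nonZero = ℕ.m*n≢0 (D ^ s) D
    side-nonZero : NonZero side
    side-nonZero = ℕ.m*n≢0 (suc (s + suc k)) (D ^ s * D)
    side²-nonZero : NonZero (side * side)
    side²-nonZero = ℕ.m*n≢0 side side
    lap-nonZero : NonZero (s + suc k)
    lap-nonZero = >-nonZero (ℕ.≤-trans (s≤s z≤n) (ℕ.m≤n+m (suc k) s))

  rate>0 : 0 < rate
  rate>0 = >-nonZero⁻¹ rate ⦃ ℕ.m*n≢0 (D ^ s * D) _ ⦃ Δ-nonZero ⦄
    ⦃ ℕ.m*n≢0 ((s + suc k) * (D ^ s * D)) (side * side) ⦃ ℕ.m*n≢0 (s + suc k) (D ^ s * D) ⦄ ⦄ ⦄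

  module Member (h : ℕ) (k<h : k < h) where

    -- With this `m`, the guaranteed `m ∸ k` kept passes are `h` in number. `Y₀` bounds the vertical
    -- extent of a route, and `Y` leaves room for that and for `Y₀` starting ordinates.
    m = k + h
    Y₀ = m * (side * side)
    X = side * suc m
    Y = Y₀ + Y₀

    m>0 : 0 < m
    m>0 = ℕ.≤-trans k>0 (ℕ.m≤m+n k h)

    instance
      Y₀-nonZero : NonZero Y₀
      Y₀-nonZero = ℕ.m*n≢0 m (side * side) ⦃ >-nonZero m>0 ⦄
      X-nonZero : NonZero X
      X-nonZero = ℕ.m*n≢0 side (suc m)
      Y-nonZero : NonZero Y
      Y-nonZero = >-nonZero (ℕ.≤-trans (>-nonZero⁻¹ Y₀) (ℕ.m≤m+n Y₀ Y₀))

    open Obstacles D s k X Y public hiding (lap-nonZero)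

    slope≤side : ∀ j → slope j ≤ side
    slope≤side j = ℕ.≤-trans (ℕ.+-monoʳ-≤ (lap * Δ) (ℕ.<⇒≤ (Fin.toℕ<n j))) (ℕ.≤-reflexive (ℕ.+-comm (lap * Δ) Δ))

    wide : ∀ {a} j → a < lap * Δ → a + m * slope j < X
    wide {a} j a< = begin-strict
      a + m * slope j     <⟨ ℕ.+-mono-<-≤ a< (ℕ.*-monoʳ-≤ m (slope≤side j)) ⟩
      lap * Δ + m * side  ≤⟨ ℕ.+-monoˡ-≤ (m * side) (ℕ.m≤n+m (lap * Δ) Δ) ⟩
      suc m * side        ≡⟨ ℕ.*-comm (suc m) side ⟩
      X                   ∎
      where open ℕ.≤-Reasoning

    tall : ∀ {b} j → b < Y₀ → b + m * (slope j * slope j) < Y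
    tall j b< = ℕ.+-mono-<-≤ b< (ℕ.*-monoʳ-≤ m (ℕ.*-mono-≤ (slope≤side j) (slope≤side j)))

    open Demands Y₀ m m>0 wide tall public

    m*m≤order : m * m ≤ order
    m*m≤order = ℕ.≤-trans (ℕ.*-mono-≤ m≤X m≤Y) (ℕ.m≤m*n (X * Y) (suc s * D ^ s + Δ * k)
      ⦃ >-nonZero (ℕ.≤-trans (>-nonZero⁻¹ (D ^ s)) (ℕ.≤-trans (ℕ.m≤m+n (D ^ s) (s * D ^ s)) (ℕ.m≤m+n _ _))) ⦄)
      where
      m≤X : m ≤ X
      m≤X = ℕ.≤-trans (ℕ.n≤1+n m) (ℕ.m≤n*m (suc m) side)
      m≤Y : m ≤ Y
      m≤Y = ℕ.≤-trans (ℕ.m≤m*n m (side * side)) (ℕ.m≤m+n Y₀ Y₀)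

    h≤order : h ≤ order
    h≤order = ℕ.≤-trans (ℕ.m≤n+m h k) (ℕ.≤-trans (ℕ.m≤m*n m m ⦃ >-nonZero m>0 ⦄) m*m≤order)

    few-demands : length demands * length demands ≤ rate * rate * order
    few-demands = begin
      length demands * length demands ≡⟨ cong (λ l → l * l) length-demands ⟩
      Δ * (lap * Δ * (m * (side * side))) * (Δ * (lap * Δ * (m * (side * side))))
        ≡⟨ regroup Δ (lap * Δ) m (side * side) ⟩
      rate * rate * (m * m)           ≤⟨ ℕ.*-monoʳ-≤ (rate * rate) m*m≤order ⟩
      rate * rate * order             ∎
      where
      open ℕ.≤-Reasoning
      regroup : ∀ w l m q → w * (l * (m * q)) * (w * (l * (m * q))) ≡ w * (l * q) * (w * (l * q)) * (m * m)
      regroup = solve-∀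

    -- Each cell offers `Δ * s` disjoint crossing edges against `suc s * D ^ s + Δ * k` vertices.
    cell-density : 8 * c * (suc s * D ^ s + Δ * k) < Δ * s
    cell-density = begin-strict
      8 * c * (suc s * D ^ s + D ^ s * D * k)  ≡⟨ regroup (8 * c) (suc s) (D ^ s) D k ⟩
      D ^ s * (8 * c * (suc s + D * k))        <⟨ ℕ.*-monoʳ-< (D ^ s) word-density ⟩
      D ^ s * (D * s)                          ≡⟨ ℕ.*-assoc (D ^ s) D s ⟨
      D ^ s * D * s                            ∎
      where
      open ℕ.≤-Reasoning
      regroup : ∀ e t w d k → e * (t * w + w * d * k) ≡ w * (e * (t + d * k))
      regroup = solve-∀
      -- The two sides of `word-density` differ by an explicit last term, positive since `c > 0`.
      surplus : ∀ k c → (32 * c + 1) * (16 * c * suc k) ≡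
        8 * c * (suc (16 * c * suc k) + (32 * c + 1) * k) + 8 * c * (16 * c * k + 48 * c + k + 1)
      surplus = solve-∀
      word-density : 8 * c * (suc s + D * k) < D * s
      word-density = subst (8 * c * (suc s + D * k) <_) (sym (surplus k c))
        (ℕ.m<m+n _ (ℕ.*-mono-≤ (ℕ.≤-trans c>0 (ℕ.m≤n*m c 8)) (ℕ.m≤n+m 1 (16 * c * k + 48 * c + k))))

    -- The factor 8 = 2 · 2 · 2 pays for side ≤ 2 lap Δ, m + 1 ≤ 2 h and Y = 2 Y₀.
    density : c * order < Δ * (lap * Δ * Y₀) * (m ∸ k) * s
    density = begin-strict
      c * (side * suc m * (Y₀ + Y₀) * nodes)
        ≤⟨ ℕ.*-monoʳ-≤ c (ℕ.*-monoˡ-≤ nodes (ℕ.*-monoˡ-≤ (Y₀ + Y₀) (ℕ.*-mono-≤ side≤ suc-m≤))) ⟩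
      c * ((lap * Δ + lap * Δ) * (h + h) * (Y₀ + Y₀) * nodes)
        ≡⟨ regroup c (lap * Δ) h Y₀ nodes ⟩
      lap * Δ * h * Y₀ * (8 * c * nodes)
        <⟨ ℕ.*-monoʳ-< (lap * Δ * h * Y₀) ⦃ bulk-nonZero ⦄ cell-density ⟩
      lap * Δ * h * Y₀ * (Δ * s)
        ≡⟨ reorder (lap * Δ) h Y₀ Δ s ⟩
      Δ * (lap * Δ * Y₀) * h * s
        ≡⟨ cong (λ t → Δ * (lap * Δ * Y₀) * t * s) (ℕ.m+n∸m≡n k h) ⟨
      Δ * (lap * Δ * Y₀) * (m ∸ k) * s ∎
      where
      open ℕ.≤-Reasoning
      nodes = suc s * D ^ s + Δ * k
      side≤ : side ≤ lap * Δ + lap * Δ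
      side≤ = ℕ.+-monoˡ-≤ (lap * Δ) (ℕ.m≤n*m Δ lap)
      suc-m≤ : suc m ≤ h + h
      suc-m≤ = ℕ.+-monoˡ-≤ h k<h
      bulk-nonZero : NonZero (lap * Δ * h * Y₀)
      bulk-nonZero = ℕ.m*n≢0 (lap * Δ * h) Y₀ ⦃ ℕ.m*n≢0 (lap * Δ) h
        ⦃ ℕ.m*n≢0 lap Δ ⦄ ⦃ >-nonZero (ℕ.≤-<-trans z≤n k<h) ⦄ ⦄
      regroup : ∀ c l h y n → c * ((l + l) * (h + h) * (y + y) * n) ≡ l * h * y * (8 * c * n)
      regroup = solve-∀
      reorder : ∀ l h y d s → l * h * y * (d * s) ≡ d * (l * y) * h * s
      reorder = solve-∀

-- Abstract, since the with-abstractions of theorem4 would otherwise unfold the power in rate.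
abstract
  dense-family : ∀ k c → 0 < k → 0 < c →
    Σ[ r ∈ ℕ ] 0 < r × (∀ h → k < h →
      Σ[ n ∈ ℕ ] h ≤ n × Σ[ G ∈ Graph n ] Σ[ P ∈ List (Fin n × Fin n) ]
        Unique P × length P * length P ≤ r * r * n ×
        (∀ P′ H → (∀ {d} → d ∈ P → d ∈ P′) → IsPairwiseSpanner k G P′ H → c * n < ∣E H ∣))
  dense-family k c k>0 c>0 = rate , rate>0 , λ h k<h →
    let open Member h k<h in
    order , h≤order , obstacleGraph , demands , demands-unique , few-demands , λ P′ H ⊆P′ spanner →
      ℕ.<-≤-trans density (spanner-size H ⊆P′ spanner)
    where open Sizes k c k>0 c>0

-- Rational constants and padding to exactly `p n` demands.

ℕ→ℚ-* : ∀ a b → ℕ→ℚ a ℚ.* ℕ→ℚ b ≡ ℕ→ℚ (a * b)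
ℕ→ℚ-* a b = ℚ.toℚᵘ-injective (ℚᵘ.≃-trans (ℚ.toℚᵘ-homo-* (ℕ→ℚ a) (ℕ→ℚ b))
  (ℚᵘ.*≡* (cong (ℤ._* + 1) (sym (ℤ.pos-* a b)))))

ℕ→ℚ-cancel-≤ : ∀ {a b} → ℕ→ℚ a ℚ.≤ ℕ→ℚ b → a ≤ b
ℕ→ℚ-cancel-≤ {a} {b} (ℚ.*≤* le) = ℤ.drop‿+≤+ (ℤ.*-cancelʳ-≤-pos (+ a) (+ b) (+ 1) le)

ℕ→ℚ-cancel-< : ∀ {a b} → ℕ→ℚ a ℚ.< ℕ→ℚ b → a < b
ℕ→ℚ-cancel-< {a} {b} (ℚ.*<* lt) = ℤ.drop‿+<+ (ℤ.*-cancelʳ-<-nonNeg {+ a} {+ b} (+ 1) lt)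

0<ℕ→ℚ : ∀ {a} → 0 < a → 0ℚ ℚ.< ℕ→ℚ a
0<ℕ→ℚ {suc a} _ = ℚ.*<* (ℤ.+<+ (s≤s z≤n))

-- Denominators are at least 1, so the numerator already bounds a nonnegative rational; adding 1
-- makes the bound positive.
ceiling : ∀ (C : ℚ) → Σ[ c ∈ ℕ ] 0 < c × C ℚ.≤ ℕ→ℚ c
ceiling C@(ℚ.mkℚ (+ a) d _) = suc a , s≤s z≤n ,
  ℚ.*≤* (subst₂ ℤ._≤_ (ℤ.pos-* a 1) (ℤ.pos-* (suc a) (suc d)) (ℤ.+≤+ (ℕ.*-mono-≤ (ℕ.n≤1+n a) (s≤s z≤n))))
ceiling C@(ℚ.mkℚ ℤ.-[1+ a ] d _) = 1 , s≤s z≤n , ℚ.*≤* ℤ.-≤+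

length-pairs : ∀ n → n ^ 2 ≡ length (cartesianProduct (allFin n) (allFin n))
length-pairs n = trans (cong (n *_) (ℕ.*-identityʳ n)) (sym (trans (length-cartesianProduct (allFin n) (allFin n))
  (cong₂ _*_ (length-tabulate {n = n} id) (length-tabulate {n = n} id))))

-- Enlarging the demand set is harmless, since a spanner for the larger set is one for the smaller.
extend-demands : ∀ {n q} {P : List (Fin n × Fin n)} → Unique P → length P ≤ q → q ≤ n ^ 2 →
  Σ[ P′ ∈ List (Fin n × Fin n) ] Unique P′ × length P′ ≡ q × (∀ {d} → d ∈ P → d ∈ P′)
extend-demands {n} {q} {P} unique P≤q q≤n²
  with P′ , unique′ , length′ , P⊆P′ ← unique-extend (≡-dec Fin._≟_ Fin._≟_) (q ∸ length P) unique
         (Unique.cartesianProduct⁺ (Unique.allFin⁺ n) (Unique.allFin⁺ n))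
         (subst₂ _≤_ (sym (ℕ.m∸n+n≡m P≤q)) (length-pairs n) q≤n²)
  = P′ , unique′ , trans length′ (ℕ.m∸n+n≡m P≤q) , P⊆P′

-- Converts the squared form of `p n = ω(√n)`, taken with the constant `rate`, into a comparison
-- with the number of demands.
≤-from-squares : ∀ {a b c n} → a * a ≤ c * c * n →
  ℕ→ℚ c ℚ.* ℕ→ℚ c ℚ.* ℕ→ℚ n ℚ.< ℕ→ℚ b ℚ.* ℕ→ℚ b → a ≤ b
≤-from-squares {a} {b} {c} {n} a²≤ lt = ℕ.≮⇒≥ λ b<a → ℕ.<-irrefl refl (begin-strict
  a * a      ≤⟨ a²≤ ⟩
  c * c * n  <⟨ ℕ→ℚ-cancel-< (subst₂ ℚ._<_
                  (trans (cong (ℚ._* ℕ→ℚ n) (ℕ→ℚ-* c c)) (ℕ→ℚ-* (c * c) n)) (ℕ→ℚ-* b b) lt) ⟩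
  b * b      ≤⟨ ℕ.*-mono-≤ (ℕ.<⇒≤ b<a) (ℕ.<⇒≤ b<a) ⟩
  a * a      ∎)
  where open ℕ.≤-Reasoning

≤-from-ratio : ∀ {C c e n} → C ℚ.≤ ℕ→ℚ c → ℕ→ℚ e ℚ.≤ C ℚ.* ℕ→ℚ n → e ≤ c * n
≤-from-ratio {C} {c} {e} {n} C≤c e≤ = ℕ→ℚ-cancel-≤ (ℚ.≤-trans e≤
  (subst (C ℚ.* ℕ→ℚ n ℚ.≤_) (ℕ→ℚ-* c n) (ℚ.*-monoʳ-≤-nonNeg (ℕ→ℚ n) C≤c)))

theorem4 : (k : ℕ) → 0 < k →
    (p : ℕ → ℕ) → p isω√n → (∀ n → p n ≤ n ^ 2) →
    (C : ℚ) → 0ℚ ℚ.< C →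
    InfinitelyMany (λ n →
      Σ[ G ∈ Graph n ] Σ[ P ∈ List (Fin n × Fin n) ]
        Unique P × length P ≡ p n ×
        (∀ (H : Graph n) → H ⊆ᴳ G → ℕ→ℚ ∣E H ∣ ℚ.≤ C ℚ.* ℕ→ℚ n →
          ¬ IsPairwiseSpanner k G P H))
theorem4 k k>0 p p-ω p≤n² C C>0 N
  with c , c>0 , C≤c ← ceiling C
  with r , r>0 , family ← dense-family k c k>0 c>0
  with N₀ , large ← p-ω (ℕ→ℚ r) (0<ℕ→ℚ r>0)
  -- This argument exceeds `k` and pushes `n` past both the requested `N` and the threshold `N₀` of
  -- the growth hypothesis.
  with n , h≤n , G , P , unique , few , dense ← family (suc k + N + N₀)
         (ℕ.≤-trans (ℕ.m≤m+n (suc k) N) (ℕ.m≤m+n (suc k + N) N₀))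
  with P′ , unique′ , length′ , P⊆P′ ← extend-demands unique
         (≤-from-squares {b = p n} {c = r} few (large n (ℕ.≤-trans (ℕ.m≤n+m N₀ (suc k + N)) h≤n))) (p≤n² n)
  = n , ℕ.≤-trans (ℕ.≤-trans (ℕ.m≤n+m N (suc k)) (ℕ.m≤m+n (suc k + N) N₀)) h≤n ,
    G , P′ , unique′ , length′ , λ H _ sparse spanner →
      ℕ.<⇒≱ (dense P′ H P⊆P′ spanner) (≤-from-ratio {c = c} C≤c sparse)
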